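{- For every integer $k \geq 3$ there is a function $f_k:\mathbb{N}\to\mathbb{R}$ with $f_k(n)=o(n)$ such that every graph $G$ with $n$ vertices and minimum degree $\delta(G) \geq n\left(1-\frac{1}{9k^{10}}\right)+f_k(n)$ has a fractional $K_k$-decomposition.
   Context: All graphs are finite, undirected and simple; $K_k$ is the complete graph on $k$ vertices. For a fixed graph $H$, a fractional $H$-decomposition of a graph $G$ is an assignment of nonnegative real weights to the copies of $H$ in $G$ (i.e. subgraphs of $G$ isomorphic to $H$) such that for each edge $e \in E(G)$, the sum of the weights of the copies of $H$ containing $e$ is exactly one. -}

module Defs where

open import Data.Bool using (Bool; true; false; _∧_; _∨_; not; if_then_else_)
open import Data.Nat as ℕ using (ℕ; zero; suc; _^_; _≡ᵇ_)
open import Data.Nat.Properties using (m*n≢0; m^n≢0)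
open import Data.Fin using (Fin; _≟_)
open import Data.Fin.Subset using (Subset; inside; outside; ∣_∣; _∈_)
open import Data.Vec as Vec using (Vec; []; _∷_; lookup)
open import Data.List as List using (List; []; _∷_; _++_; map; filter; allFin)
open import Data.List.Relation.Unary.All using (All)
open import Data.Product using (Σ; ∃; ∃-syntax; _×_; _,_)
open import Relation.Nullary.Decidable using (⌊_⌋)
open import Relation.Binary.PropositionalEquality using (_≡_; _≢_)
open import Data.Integer as ℤ using (+_)
open import Data.Rational as ℚ using (ℚ; 0ℚ; 1ℚ; _≤_; _<_; _+_; _*_; _-_) renaming (∣_∣ to abs)

record Graph (n : ℕ) : Set where
  field
    adj    : Fin n → Fin n → Bool
    sym    : ∀ i j → adj i j ≡ adj j i
    irrefl : ∀ i → adj i i ≡ false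
open Graph public

Edge : ∀ {n} → Graph n → Fin n → Fin n → Set
Edge G i j = adj G i j ≡ true

count : List Bool → ℕ
count []           = 0
count (true ∷ bs)  = suc (count bs)
count (false ∷ bs) = count bs

degree : ∀ {n} → Graph n → Fin n → ℕ
degree {n} G i = count (map (adj G i) (allFin n))

allB : ∀ {A : Set} → (A → Bool) → List A → Bool
allB p []       = true
allB p (x ∷ xs) = p x ∧ allB p xs

filterB : ∀ {A : Set} → (A → Bool) → List A → List A
filterB p []       = []
filterB p (x ∷ xs) = if p x then x ∷ filterB p xs else filterB p xs

mem : ∀ {n} → Fin n → Subset n → Bool
mem i S with lookup S i
... | inside  = true
... | outside = false

subsets : ∀ n → List (Subset n)
subsets zero    = Vec.[] ∷ []
subsets (suc n) = map (inside Vec.∷_) (subsets n) ++ map (outside Vec.∷_) (subsets n)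

-- Copies of K_k in G: a subgraph of G isomorphic to K_k is determined by
-- its vertex set, which is a k-element set of pairwise adjacent vertices.
isClique : ∀ {n} → Graph n → Subset n → Bool
isClique {n} G S =
  allB (λ i → allB (λ j →
     not (mem i S ∧ mem j S) ∨ ⌊ i ≟ j ⌋ ∨ adj G i j) (allFin n)) (allFin n)

isKkCopy : ∀ {n} → ℕ → Graph n → Subset n → Bool
isKkCopy k G S = (∣ S ∣ ≡ᵇ k) ∧ isClique G S

copies : ∀ {n} → ℕ → Graph n → List (Subset n)
copies {n} k G = filterB (isKkCopy k G) (subsets n)

copiesThrough : ∀ {n} → ℕ → Graph n → Fin n → Fin n → List (Subset n)
copiesThrough k G i j = filterB (λ S → mem i S ∧ mem j S) (copies k G)

sumℚ : List ℚ → ℚ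
sumℚ = List.foldr _+_ 0ℚ

FractionalDecomposition : ∀ {n} → ℕ → Graph n → Set
FractionalDecomposition {n} k G =
  Σ (Subset n → ℚ) λ w →
    All (λ S → 0ℚ ≤ w S) (copies k G) ×
    (∀ i j → Edge G i j → sumℚ (map w (copiesThrough k G i j)) ≡ 1ℚ)

MinDegreeAtLeast : ∀ {n} → Graph n → ℚ → Set
MinDegreeAtLeast {n} G d = ∀ (v : Fin n) → d ≤ (+ degree G v) ℚ./ 1

fromℕ : ℕ → ℚ
fromℕ m = (+ m) ℚ./ 1

IsLittleO : (ℕ → ℚ) → Set
IsLittleO f = ∀ (ε : ℚ) → 0ℚ < ε → ∃[ N ] ∀ m → N ℕ.≤ m → abs (f m) ≤ ε * fromℕ m

-- 1 / (9 k^10), for k ≥ 1 (k = 0 is never used)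
inv9k10 : ℕ → ℚ
inv9k10 zero    = 0ℚ
inv9k10 (suc k) = ℚ._/_ (+ 1) (9 ℕ.* suc k ^ 10) {{m*n≢0 9 (suc k ^ 10) {{_}} {{m^n≢0 (suc k) 10}}}}

{-
A K_{k+2} whose edges carry weights x has an explicit decomposition into
K_k's: if d(p) is the total weight at p and D the sum of all d(p), give the
K_k that omits p and q the weight
  (D − k(d(p) + d(q))) / (k(k−1)) + x(pq).
These weights are nonnegative as soon as the values of x lie within a factor
1 + 1/(k²+k) of one another.

Let N(e) be the number of (k+2)-cliques of G through the edge e, and put the
weight 1/N(e) on e inside each of them, so that the weights of e add up to 1
over all these cliques.  With ε = 1/(9k¹⁰), every vertex has at most εn
non-neighbours (itself included), so extending e one vertex at a time gives
  (n(1 − (k+2)ε))^k ≤ k! N(e) ≤ n^k;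
the numbers N(e) are therefore close enough to one another for every clique to
be decomposed with nonnegative weights.  The argument has no error term: f = 0.
-}
module Submission where

open import Defs
open import Data.Nat using (ℕ; _≤_)
open import Data.Product using (Σ; _×_)
open import Data.Rational using (ℚ; 1ℚ; _+_; _*_; _-_)

import Data.Rational
open import Algebra.Definitions.RawSemiring Data.Rational.+-*-rawSemiring using (_^_)
open import Data.Bool using (Bool; true; false; _∧_; _∨_; not; if_then_else_)
open import Data.Bool.Properties using (T-≡; T-∧) renaming (_≟_ to _≟ᴮ_)
open import Data.Empty using (⊥-elim)
open import Data.Fin using (Fin; zero; suc; _≟_)
open import Data.Fin.Properties using (any?)
open import Data.Fin.Subset using (Subset; inside; outside; ∣_∣; _⊆_; ⊥)
open import Data.Fin.Subset.Properties
  using (_⊆?_; _∈?_; ⊆-antisym; ⊆-refl; p⊂q⇒∣p∣<∣q∣; ⊥⊆; ∣⊥∣≡0)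
open import Data.Integer as ℤ using () renaming (+_ to pos)
open import Data.Integer.Tactic.RingSolver using () renaming (solve-∀ to solve-∀ᶻ)
open import Data.List using (List; []; _∷_; _++_; map; allFin)
open import Data.List.Membership.Propositional using () renaming (_∈_ to _∈ˡ_)
open import Data.List.Membership.Propositional.Properties using (∈-allFin)
open import Data.List.Properties using (map-tabulate)
open import Data.List.Relation.Unary.All as All using ()
open import Data.List.Relation.Unary.Any using (here; there)
open import Data.Nat as ℕ using (zero; suc)
open import Data.Nat.Properties as ℕₚ using (m^n≢0; m*n≢0; ^-monoʳ-≤)
open import Data.Nat.Tactic.RingSolver using () renaming (solve-∀ to solve-∀ᴺ)
open import Data.Product using (_,_; proj₁; proj₂)
open import Data.Rational using (0ℚ; -_; toℚᵘ; _/_; Positive; positive; nonNegative)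
  renaming (_≤_ to _≤ᵠ_; _<_ to _<ᵠ_)
open import Data.Rational.Properties as ℚₚ using (_<?_)
open import Data.Rational.Solver using (module +-*-Solver)
open import Data.Rational.Unnormalised as ℚᵘ using ()
open import Data.Rational.Unnormalised.Properties as ℚᵘₚ using ()
open import Data.Sum using (_⊎_; inj₁; inj₂)
open import Data.Vec using ([]; _∷_; lookup; _[_]≔_)
open import Data.Vec.Properties
  using (≡-dec; lookup∘update; lookup∘update′; lookup⇒[]=; []=⇒lookup; lookup-replicate)
open import Function using (_∘_; Equivalence)
open import Relation.Binary.PropositionalEquality
  using (_≡_; _≢_; refl; trans; cong; cong₂; subst; subst₂; module ≡-Reasoning)
  renaming (sym to ≡-sym)
open import Relation.Nullary using (yes; no; contradiction)
open import Relation.Nullary.Decidable using (⌊_⌋; _×-dec_)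
open +-*-Solver using (solve; _:=_; _:+_; _:*_; _:-_; con)

-- Rational arithmetic

-- The k-cliques of K_{k+2}, indexed by the pair that they omit, are as many as its edges, so
-- prescribing the edge weights x is a square linear system: the values y(pq) on the pairs disjoint
-- from uv have to sum to x(uv). With T the total of y and s(p) its sum at p, this reads T - s(u) -
-- s(v) + y(uv) = x(uv). Summing over v gives s(u) = T - d(u)/(k-1), summing over u as well gives T
-- = D/(k(k-1)), and substituting back yields the formula for y. The tolerance is what crude bounds
-- leave: for weights in [m, M] every d(p) is at most (k+1)M and D is at least (k+2)(k+1)m, which
-- makes k(k-1)y at least 2((k²+k+1)m - (k²+k)M). In the quotient of the two bounds on N(e) both k!
-- and n^k cancel. What remains is (1 - (k+2)ε)^k, at least 1 - k(k+2)ε by Bernoulli, so the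
-- condition to be met is k(k+2)(k²+k+1)ε ≤ 1.

2ℚ : ℚ
2ℚ = 1ℚ + 1ℚ

-- Arithmetic in `ℚ` normalises by a gcd and is stuck on open terms. In the unnormalised rationals
-- the identities about `fromℕ` become integer equations.
fromℕ-toℚᵘ : ∀ m → toℚᵘ (fromℕ m) ℚᵘ.≃ ℚᵘ.mkℚᵘ (pos m) 0
fromℕ-toℚᵘ m = ℚₚ.toℚᵘ-fromℚᵘ (ℚᵘ.mkℚᵘ (pos m) 0)

fromℕ-+ : ∀ a b → fromℕ (a ℕ.+ b) ≡ fromℕ a + fromℕ b
fromℕ-+ a b = ℚₚ.toℚᵘ-injective (begin
  toℚᵘ (fromℕ (a ℕ.+ b))                       ≈⟨ fromℕ-toℚᵘ (a ℕ.+ b) ⟩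
  ℚᵘ.mkℚᵘ (pos (a ℕ.+ b)) 0                      ≈⟨ ℚᵘ.*≡* (cross-multiplied (pos a) (pos b)) ⟩
  ℚᵘ.mkℚᵘ (pos a) 0 ℚᵘ.+ ℚᵘ.mkℚᵘ (pos b) 0         ≈⟨ ℚᵘₚ.+-cong (fromℕ-toℚᵘ a) (fromℕ-toℚᵘ b) ⟨
  toℚᵘ (fromℕ a) ℚᵘ.+ toℚᵘ (fromℕ b)           ≈⟨ ℚₚ.toℚᵘ-homo-+ (fromℕ a) (fromℕ b) ⟨
  toℚᵘ (fromℕ a + fromℕ b)                     ∎)
  where
  open ℚᵘₚ.≃-Reasoning
  cross-multiplied : ∀ i j → (i ℤ.+ j) ℤ.* (pos 1) ≡ (i ℤ.* pos 1 ℤ.+ j ℤ.* (pos 1)) ℤ.* (pos 1)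
  cross-multiplied = solve-∀ᶻ

fromℕ-suc : ∀ a → fromℕ (suc a) ≡ 1ℚ + fromℕ a
fromℕ-suc = fromℕ-+ 1

fromℕ-* : ∀ a b → fromℕ (a ℕ.* b) ≡ fromℕ a * fromℕ b
fromℕ-* zero    b = ≡-sym (ℚₚ.*-zeroˡ (fromℕ b))
fromℕ-* (suc a) b = begin
  fromℕ (b ℕ.+ a ℕ.* b)          ≡⟨ fromℕ-+ b (a ℕ.* b) ⟩
  fromℕ b + fromℕ (a ℕ.* b)      ≡⟨ cong (fromℕ b +_) (fromℕ-* a b) ⟩
  fromℕ b + fromℕ a * fromℕ b    ≡⟨ solve 2 (λ x y → y :+ x :* y := (con 1ℚ :+ x) :* y) refl (fromℕ a) (fromℕ b) ⟩
  (1ℚ + fromℕ a) * fromℕ b       ≡⟨ cong (_* fromℕ b) (fromℕ-suc a) ⟨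
  fromℕ (suc a) * fromℕ b        ∎
  where open ≡-Reasoning

p≤q⇒0≤q-p : ∀ {p q} → p ≤ᵠ q → 0ℚ ≤ᵠ q - p
p≤q⇒0≤q-p {p} {q} p≤q = subst (_≤ᵠ q - p) (ℚₚ.+-inverseʳ p) (ℚₚ.+-monoˡ-≤ (- p) p≤q)

0≤q-p⇒p≤q : ∀ {p q} → 0ℚ ≤ᵠ q - p → p ≤ᵠ q
0≤q-p⇒p≤q {p} {q} h = subst₂ _≤ᵠ_ (ℚₚ.+-identityˡ p) (solve 2 (λ p q → q :- p :+ p := q) refl p q)
  (ℚₚ.+-monoˡ-≤ p h)

0≤p+q : ∀ {p q} → 0ℚ ≤ᵠ p → 0ℚ ≤ᵠ q → 0ℚ ≤ᵠ p + q
0≤p+q = ℚₚ.+-mono-≤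

*-monoʳ-≤ : ∀ {r p q} → 0ℚ ≤ᵠ r → p ≤ᵠ q → r * p ≤ᵠ r * q
*-monoʳ-≤ {r} 0≤r = ℚₚ.*-monoˡ-≤-nonNeg r {{nonNegative 0≤r}}

0≤p*q : ∀ {p q} → 0ℚ ≤ᵠ p → 0ℚ ≤ᵠ q → 0ℚ ≤ᵠ p * q
0≤p*q {p} {q} 0≤p 0≤q = subst (_≤ᵠ p * q) (ℚₚ.*-zeroʳ p) (*-monoʳ-≤ 0≤p 0≤q)

0≤1 : 0ℚ ≤ᵠ 1ℚ
0≤1 = ℚₚ.nonNegative⁻¹ 1ℚ

0≤fromℕ : ∀ a → 0ℚ ≤ᵠ fromℕ a
0≤fromℕ zero    = ℚₚ.≤-refl
0≤fromℕ (suc a) = subst (0ℚ ≤ᵠ_) (≡-sym (fromℕ-suc a)) (0≤p+q 0≤1 (0≤fromℕ a))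

fromℕ-mono : ∀ {a b} → a ≤ b → fromℕ a ≤ᵠ fromℕ b
fromℕ-mono {b = b} ℕ.z≤n = 0≤fromℕ b
fromℕ-mono {suc a} {suc b} (ℕ.s≤s a≤b) = subst₂ _≤ᵠ_ (≡-sym (fromℕ-suc a)) (≡-sym (fromℕ-suc b))
  (ℚₚ.+-monoʳ-≤ 1ℚ (fromℕ-mono a≤b))

0<p*q : ∀ {p q} → 0ℚ <ᵠ p → 0ℚ <ᵠ q → 0ℚ <ᵠ p * q
0<p*q {p} {q} 0<p 0<q = ℚₚ.positive⁻¹ (p * q) {{ℚₚ.pos*pos⇒pos p {{positive 0<p}} q {{positive 0<q}}}}

0<fromℕ : ∀ a → 0ℚ <ᵠ fromℕ (suc a)
0<fromℕ a = ℚₚ.<-≤-trans (ℚₚ.positive⁻¹ 1ℚ) (fromℕ-mono (ℕ.s≤s (ℕ.z≤n {a})))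

inverse : ∀ {p} → 0ℚ <ᵠ p → Σ ℚ λ q → 0ℚ ≤ᵠ q × p * q ≡ 1ℚ
inverse {p} 0<p = _ , ℚₚ.<⇒≤ (ℚₚ.positive⁻¹ _ {{ℚₚ.1/pos⇒pos p}}) , ℚₚ.*-inverseʳ p {{ℚₚ.pos⇒nonZero p}}
  where instance
    p-pos : Positive p
    p-pos = positive 0<p

-- Finite sums and indicators

∑ : ∀ {A : Set} → List A → (A → ℚ) → ℚ
∑ xs f = sumℚ (map f xs)

∑-cong : ∀ {A : Set} (xs : List A) {f g : A → ℚ} → (∀ x → f x ≡ g x) → ∑ xs f ≡ ∑ xs g
∑-cong []       e = refl
∑-cong (x ∷ xs) e = cong₂ _+_ (e x) (∑-cong xs e)

∑-mono : ∀ {A : Set} (xs : List A) {f g : A → ℚ} → (∀ x → f x ≤ᵠ g x) → ∑ xs f ≤ᵠ ∑ xs g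
∑-mono []       h = ℚₚ.≤-refl
∑-mono (x ∷ xs) h = ℚₚ.+-mono-≤ (h x) (∑-mono xs h)

∑-nonneg : ∀ {A : Set} (xs : List A) {f : A → ℚ} → (∀ x → 0ℚ ≤ᵠ f x) → 0ℚ ≤ᵠ ∑ xs f
∑-nonneg []       h = ℚₚ.≤-refl
∑-nonneg (x ∷ xs) h = 0≤p+q (h x) (∑-nonneg xs h)

∑-zero : ∀ {A : Set} (xs : List A) → ∑ xs (λ _ → 0ℚ) ≡ 0ℚ
∑-zero []       = refl
∑-zero (x ∷ xs) = trans (ℚₚ.+-identityˡ _) (∑-zero xs)

∑-+ : ∀ {A : Set} (xs : List A) (f g : A → ℚ) → ∑ xs (λ x → f x + g x) ≡ ∑ xs f + ∑ xs g
∑-+ []       f g = refl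
∑-+ (x ∷ xs) f g = trans (cong (λ s → f x + g x + s) (∑-+ xs f g))
  (solve 4 (λ a b s t → a :+ b :+ (s :+ t) := a :+ s :+ (b :+ t)) refl (f x) (g x) (∑ xs f) (∑ xs g))

∑-- : ∀ {A : Set} (xs : List A) (f g : A → ℚ) → ∑ xs (λ x → f x - g x) ≡ ∑ xs f - ∑ xs g
∑-- []       f g = refl
∑-- (x ∷ xs) f g = trans (cong (λ s → f x - g x + s) (∑-- xs f g))
  (solve 4 (λ a b s t → a :- b :+ (s :- t) := a :+ s :- (b :+ t)) refl (f x) (g x) (∑ xs f) (∑ xs g))

∑-*ˡ : ∀ {A : Set} (xs : List A) c (f : A → ℚ) → ∑ xs (λ x → c * f x) ≡ c * ∑ xs f
∑-*ˡ []       c f = ≡-sym (ℚₚ.*-zeroʳ c)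
∑-*ˡ (x ∷ xs) c f = trans (cong (c * f x +_) (∑-*ˡ xs c f)) (≡-sym (ℚₚ.*-distribˡ-+ c (f x) (∑ xs f)))

∑-*ʳ : ∀ {A : Set} (xs : List A) c (f : A → ℚ) → ∑ xs (λ x → f x * c) ≡ ∑ xs f * c
∑-*ʳ xs c f = trans (∑-cong xs λ x → ℚₚ.*-comm (f x) c) (trans (∑-*ˡ xs c f) (ℚₚ.*-comm c (∑ xs f)))

-- Both summations in the clique identity have this shape: an indicator times an expression affine
-- in `d` and in a term built from `x`.
∑-affine : ∀ {A : Set} (xs : List A) (σ f g : A → ℚ) a b c →
  ∑ xs (λ x → σ x * (a + b * f x + c * g x))
    ≡ a * ∑ xs σ + b * ∑ xs (λ x → σ x * f x) + c * ∑ xs (λ x → σ x * g x)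
∑-affine []       σ f g a b c = solve 3 (λ a b c → con 0ℚ := a :* con 0ℚ :+ b :* con 0ℚ :+ c :* con 0ℚ) refl a b c
∑-affine (x ∷ xs) σ f g a b c = trans (cong (σ x * (a + b * f x + c * g x) +_) (∑-affine xs σ f g a b c))
  (solve 9 (λ a b c s y z S Y Z →
      s :* (a :+ b :* y :+ c :* z) :+ (a :* S :+ b :* Y :+ c :* Z)
        := a :* (s :+ S) :+ b :* (s :* y :+ Y) :+ c :* (s :* z :+ Z)) refl
    a b c (σ x) (f x) (g x) (∑ xs σ) (∑ xs (λ x → σ x * f x)) (∑ xs (λ x → σ x * g x)))

∑-swap : ∀ {A B : Set} (xs : List A) (ys : List B) (f : A → B → ℚ) →
  ∑ xs (λ x → ∑ ys (f x)) ≡ ∑ ys (λ y → ∑ xs (λ x → f x y))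
∑-swap []       ys f = ≡-sym (∑-zero ys)
∑-swap (x ∷ xs) ys f = trans (cong (∑ ys (f x) +_) (∑-swap xs ys f))
  (≡-sym (∑-+ ys (f x) (λ y → ∑ xs (λ x → f x y))))

∑-*-swap : ∀ {A B : Set} (xs : List A) (ys : List B) (g : A → ℚ) (f : B → A → ℚ) →
  ∑ xs (λ x → g x * ∑ ys (λ y → f y x)) ≡ ∑ ys (λ y → ∑ xs (λ x → g x * f y x))
∑-*-swap xs ys g f = trans (∑-cong xs λ x → ≡-sym (∑-*ˡ ys (g x) (λ y → f y x)))
  (∑-swap xs ys (λ x y → g x * f y x))

∑-++ : ∀ {A : Set} (xs ys : List A) (f : A → ℚ) → ∑ (xs ++ ys) f ≡ ∑ xs f + ∑ ys f
∑-++ []       ys f = ≡-sym (ℚₚ.+-identityˡ _)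
∑-++ (x ∷ xs) ys f = trans (cong (f x +_) (∑-++ xs ys f)) (≡-sym (ℚₚ.+-assoc (f x) (∑ xs f) (∑ ys f)))

∑-map : ∀ {A B : Set} (h : A → B) (xs : List A) (f : B → ℚ) → ∑ (map h xs) f ≡ ∑ xs (f ∘ h)
∑-map h []       f = refl
∑-map h (x ∷ xs) f = cong (f (h x) +_) (∑-map h xs f)

⟦_⟧ : Bool → ℚ
⟦ b ⟧ = if b then 1ℚ else 0ℚ

⟦⟧-∧ : ∀ a b → ⟦ a ∧ b ⟧ ≡ ⟦ a ⟧ * ⟦ b ⟧
⟦⟧-∧ true  b = ≡-sym (ℚₚ.*-identityˡ ⟦ b ⟧)
⟦⟧-∧ false b = ≡-sym (ℚₚ.*-zeroˡ ⟦ b ⟧)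

0≤⟦⟧ : ∀ b → 0ℚ ≤ᵠ ⟦ b ⟧
0≤⟦⟧ true  = 0≤1
0≤⟦⟧ false = ℚₚ.≤-refl

-- Sums over cliques become sums over all subsets with an indicator, the form in which the order of
-- summation can be exchanged.
∑-filterB : ∀ {A : Set} (p : A → Bool) (xs : List A) (f : A → ℚ) →
  ∑ (filterB p xs) f ≡ ∑ xs (λ x → ⟦ p x ⟧ * f x)
∑-filterB p []       f = refl
∑-filterB p (x ∷ xs) f with p x
... | true  = cong₂ _+_ (≡-sym (ℚₚ.*-identityˡ (f x))) (∑-filterB p xs f)
... | false = trans (∑-filterB p xs f)
  (solve 2 (λ y s → s := con 0ℚ :* y :+ s) refl (f x) (∑ xs (λ x → ⟦ p x ⟧ * f x)))

∑ᵛ : ∀ {n} → (Fin n → ℚ) → ℚ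
∑ᵛ {n} = ∑ (allFin n)

∑ᵛ-suc : ∀ {n} (f : Fin (suc n) → ℚ) → ∑ᵛ f ≡ f zero + ∑ᵛ (f ∘ suc)
∑ᵛ-suc {n} f = cong (f zero +_) (trans (cong (λ xs → ∑ xs f) (≡-sym (map-tabulate (λ i → i) suc))) (∑-map suc (allFin n) f))

∑ᵛ-const : ∀ n c → ∑ᵛ {n} (λ _ → c) ≡ fromℕ n * c
∑ᵛ-const zero    c = ≡-sym (ℚₚ.*-zeroˡ c)
∑ᵛ-const (suc n) c = begin
  ∑ᵛ {suc n} (λ _ → c)      ≡⟨ ∑ᵛ-suc {n} (λ _ → c) ⟩
  c + ∑ᵛ {n} (λ _ → c)      ≡⟨ cong (c +_) (∑ᵛ-const n c) ⟩
  c + fromℕ n * c           ≡⟨ solve 2 (λ c m → c :+ m :* c := (con 1ℚ :+ m) :* c) refl c (fromℕ n) ⟩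
  (1ℚ + fromℕ n) * c        ≡⟨ cong (_* c) (fromℕ-suc n) ⟨
  fromℕ (suc n) * c         ∎
  where open ≡-Reasoning

δ : ∀ {n} → Fin n → Fin n → ℚ
δ i j = ⟦ ⌊ i ≟ j ⌋ ⟧

δ-refl : ∀ {n} (i : Fin n) → δ i i ≡ 1ℚ
δ-refl i with i ≟ i
... | yes _   = refl
... | no  i≢i = contradiction refl i≢i

δ-≢ : ∀ {n} {i j : Fin n} → i ≢ j → δ i j ≡ 0ℚ
δ-≢ {i = i} {j} i≢j with i ≟ j
... | yes i≡j = contradiction i≡j i≢j
... | no  _   = refl

δ-suc : ∀ {n} (i j : Fin n) → δ (suc i) (suc j) ≡ δ i j
δ-suc i j with i ≟ j
... | yes _ = refl
... | no  _ = refl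

∑ᵛ-δ : ∀ {n} (i : Fin n) (f : Fin n → ℚ) → ∑ᵛ (λ j → δ i j * f j) ≡ f i
∑ᵛ-δ {suc n} zero f = begin
  ∑ᵛ (λ j → δ zero j * f j)                        ≡⟨ ∑ᵛ-suc (λ j → δ zero j * f j) ⟩
  1ℚ * f zero + ∑ᵛ (λ j → 0ℚ * f (suc j))          ≡⟨ cong₂ _+_ (ℚₚ.*-identityˡ (f zero))
                                                        (trans (∑-*ˡ (allFin n) 0ℚ (f ∘ suc)) (ℚₚ.*-zeroˡ (∑ᵛ (f ∘ suc)))) ⟩
  f zero + 0ℚ                                      ≡⟨ ℚₚ.+-identityʳ (f zero) ⟩
  f zero                                           ∎
  where open ≡-Reasoning
∑ᵛ-δ {suc n} (suc i) f = begin
  ∑ᵛ (λ j → δ (suc i) j * f j)                                ≡⟨ ∑ᵛ-suc (λ j → δ (suc i) j * f j) ⟩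
  0ℚ * f zero + ∑ᵛ (λ j → δ (suc i) (suc j) * f (suc j))      ≡⟨ cong₂ _+_ (ℚₚ.*-zeroˡ (f zero))
                                                                   (∑-cong (allFin n) λ j → cong (_* f (suc j)) (δ-suc i j)) ⟩
  0ℚ + ∑ᵛ (λ j → δ i j * f (suc j))                           ≡⟨ ℚₚ.+-identityˡ _ ⟩
  ∑ᵛ (λ j → δ i j * f (suc j))                                ≡⟨ ∑ᵛ-δ i (f ∘ suc) ⟩
  f (suc i)                                                   ∎
  where open ≡-Reasoning

δˢ : ∀ {n} → Subset n → Subset n → ℚ
δˢ S T = ⟦ ⌊ ≡-dec _≟ᴮ_ S T ⌋ ⟧

δˢ-∷ : ∀ {n} x y (S T : Subset n) → δˢ (x ∷ S) (y ∷ T) ≡ ⟦ ⌊ x ≟ᴮ y ⌋ ⟧ * δˢ S T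
δˢ-∷ x y S T with x ≟ᴮ y | ≡-dec _≟ᴮ_ S T
... | yes _ | yes _ = refl
... | yes _ | no  _ = refl
... | no  _ | yes _ = refl
... | no  _ | no  _ = refl

-- This encodes that `subsets n` lists each subset exactly once: of its two halves only the one that
-- agrees with the head of `T` survives.
∑-δˢ : ∀ {n} (T : Subset n) (f : Subset n → ℚ) → ∑ (subsets n) (λ S → f S * δˢ S T) ≡ f T
∑-δˢ []      f = trans (ℚₚ.+-identityʳ _) (ℚₚ.*-identityʳ (f []))
∑-δˢ {suc n} (y ∷ T) f = begin
  ∑ (subsets (suc n)) F
    ≡⟨ ∑-++ (map (inside ∷_) (subsets n)) _ F ⟩
  ∑ (map (inside ∷_) (subsets n)) F + ∑ (map (outside ∷_) (subsets n)) F
    ≡⟨ cong₂ _+_ (half inside) (half outside) ⟩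
  ⟦ ⌊ inside ≟ᴮ y ⌋ ⟧ * f (inside ∷ T) + ⟦ ⌊ outside ≟ᴮ y ⌋ ⟧ * f (outside ∷ T)
    ≡⟨ select y ⟩
  f (y ∷ T) ∎
  where
  open ≡-Reasoning
  F : Subset (suc n) → ℚ
  F S = f S * δˢ S (y ∷ T)
  half : ∀ x → ∑ (map (x ∷_) (subsets n)) F ≡ ⟦ ⌊ x ≟ᴮ y ⌋ ⟧ * f (x ∷ T)
  half x = begin
    ∑ (map (x ∷_) (subsets n)) F
      ≡⟨ ∑-map (x ∷_) (subsets n) F ⟩
    ∑ (subsets n) (λ S → f (x ∷ S) * δˢ (x ∷ S) (y ∷ T))
      ≡⟨ ∑-cong (subsets n) (λ S → trans (cong (f (x ∷ S) *_) (δˢ-∷ x y S T))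
           (solve 3 (λ a b c → a :* (b :* c) := b :* (a :* c)) refl (f (x ∷ S)) ⟦ ⌊ x ≟ᴮ y ⌋ ⟧ (δˢ S T))) ⟩
    ∑ (subsets n) (λ S → ⟦ ⌊ x ≟ᴮ y ⌋ ⟧ * (f (x ∷ S) * δˢ S T))
      ≡⟨ ∑-*ˡ (subsets n) ⟦ ⌊ x ≟ᴮ y ⌋ ⟧ (λ S → f (x ∷ S) * δˢ S T) ⟩
    ⟦ ⌊ x ≟ᴮ y ⌋ ⟧ * ∑ (subsets n) (λ S → f (x ∷ S) * δˢ S T)
      ≡⟨ cong (⟦ ⌊ x ≟ᴮ y ⌋ ⟧ *_) (∑-δˢ T (λ S → f (x ∷ S))) ⟩
    ⟦ ⌊ x ≟ᴮ y ⌋ ⟧ * f (x ∷ T) ∎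
  select : ∀ y → ⟦ ⌊ inside ≟ᴮ y ⌋ ⟧ * f (inside ∷ T) + ⟦ ⌊ outside ≟ᴮ y ⌋ ⟧ * f (outside ∷ T) ≡ f (y ∷ T)
  select inside  = solve 2 (λ a b → con 1ℚ :* a :+ con 0ℚ :* b := a) refl (f (inside ∷ T)) (f (outside ∷ T))
  select outside = solve 2 (λ a b → con 0ℚ :* a :+ con 1ℚ :* b := b) refl (f (inside ∷ T)) (f (outside ∷ T))

-- Decomposing an edge-weighted K_{k+2}

-- The clique stays inside the ambient `Fin n` as a 0/1 function `χ`, which avoids relabelling its
-- vertices.
module WeightedClique {n} (κ : ℚ) (χ : Fin n → ℚ) (x : Fin n → Fin n → ℚ) where

  d : Fin n → ℚ
  d p = ∑ᵛ (λ q → χ q * x p q)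

  D : ℚ
  D = ∑ᵛ (λ p → χ p * d p)

  -- κ(κ−1) times the weight given to the κ-clique that omits p and q.
  Y : Fin n → Fin n → ℚ
  Y p q = D - κ * (d p + d q) + κ * (κ - 1ℚ) * x p q

  module Identity
    (x-sym : ∀ p q → x p q ≡ x q p)
    (x-irr : ∀ p → x p p ≡ 0ℚ)
    (χ-idem : ∀ p → χ p * χ p ≡ χ p)
    (size : ∑ᵛ χ ≡ κ + 2ℚ)
    {u v : Fin n} (u≢v : u ≢ v) (χu : χ u ≡ 1ℚ) (χv : χ v ≡ 1ℚ)
    where

    -- Indicator of the clique minus `u` and `v`: a κ-clique contains the edge uv exactly when both
    -- vertices that it omits lie here.
    σ : Fin n → ℚ
    σ p = χ p * (1ℚ - δ u p) * (1ℚ - δ v p)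

    private
      -- The product form of `σ` gives idempotence, the linear form can be summed. They agree
      -- because `u` and `v` are distinct and both belong to the clique.
      σ-linear : ∀ p → σ p ≡ χ p - δ u p - δ v p
      σ-linear p with u ≟ p | v ≟ p
      ... | yes refl | yes refl = contradiction refl u≢v
      ... | yes refl | no  _    rewrite χu = refl
      ... | no  _    | yes refl rewrite χv = refl
      ... | no  _    | no  _    = solve 1 (λ a → a :* (con 1ℚ :- con 0ℚ) :* (con 1ℚ :- con 0ℚ) := a :- con 0ℚ :- con 0ℚ) refl (χ p)

      σ-idem : ∀ p → σ p * σ p ≡ σ p
      σ-idem p with u ≟ p | v ≟ p
      ... | yes _ | b     = solve 2 (λ a c → a :* (con 1ℚ :- con 1ℚ) :* c :* (a :* (con 1ℚ :- con 1ℚ) :* c) := a :* (con 1ℚ :- con 1ℚ) :* c) refl (χ p) (1ℚ - ⟦ ⌊ b ⌋ ⟧)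
      ... | no  _ | yes _ = solve 1 (λ a → a :* (con 1ℚ :- con 0ℚ) :* (con 1ℚ :- con 1ℚ) :* (a :* (con 1ℚ :- con 0ℚ) :* (con 1ℚ :- con 1ℚ)) := a :* (con 1ℚ :- con 0ℚ) :* (con 1ℚ :- con 1ℚ)) refl (χ p)
      ... | no  _ | no  _ = trans (solve 1 (λ a → a :* (con 1ℚ :- con 0ℚ) :* (con 1ℚ :- con 0ℚ) :* (a :* (con 1ℚ :- con 0ℚ) :* (con 1ℚ :- con 0ℚ)) := a :* a) refl (χ p))
                              (trans (χ-idem p) (solve 1 (λ a → a := a :* (con 1ℚ :- con 0ℚ) :* (con 1ℚ :- con 0ℚ)) refl (χ p)))

      E : (Fin n → ℚ) → ℚ
      E f = ∑ᵛ (λ p → σ p * f p)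

      E-value : ∀ f → E f ≡ ∑ᵛ (λ p → χ p * f p) - f u - f v
      E-value f = begin
        E f
          ≡⟨ ∑-cong (allFin n) (λ p → trans (cong (_* f p) (σ-linear p))
               (solve 4 (λ a b c y → (a :- b :- c) :* y := a :* y :- b :* y :- c :* y) refl (χ p) (δ u p) (δ v p) (f p))) ⟩
        ∑ᵛ (λ p → χ p * f p - δ u p * f p - δ v p * f p)
          ≡⟨ ∑-- (allFin n) (λ p → χ p * f p - δ u p * f p) (λ p → δ v p * f p) ⟩
        ∑ᵛ (λ p → χ p * f p - δ u p * f p) - ∑ᵛ (λ p → δ v p * f p)
          ≡⟨ cong₂ _-_ (∑-- (allFin n) (λ p → χ p * f p) (λ p → δ u p * f p)) (∑ᵛ-δ v f) ⟩
        ∑ᵛ (λ p → χ p * f p) - ∑ᵛ (λ p → δ u p * f p) - f v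
          ≡⟨ cong (λ s → ∑ᵛ (λ p → χ p * f p) - s - f v) (∑ᵛ-δ u f) ⟩
        ∑ᵛ (λ p → χ p * f p) - f u - f v ∎
        where open ≡-Reasoning

      ∑σ : ∑ᵛ σ ≡ κ
      ∑σ = begin
        ∑ᵛ σ                              ≡⟨ ∑-cong (allFin n) (λ p → ≡-sym (ℚₚ.*-identityʳ (σ p))) ⟩
        E (λ _ → 1ℚ)                      ≡⟨ E-value (λ _ → 1ℚ) ⟩
        ∑ᵛ (λ p → χ p * 1ℚ) - 1ℚ - 1ℚ     ≡⟨ cong (λ s → s - 1ℚ - 1ℚ) (trans (∑-cong (allFin n) λ p → ℚₚ.*-identityʳ (χ p)) size) ⟩
        κ + 2ℚ - 1ℚ - 1ℚ                  ≡⟨ solve 1 (λ k → k :+ con 2ℚ :- con 1ℚ :- con 1ℚ := k) refl κ ⟩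
        κ                                 ∎
        where open ≡-Reasoning

      Ed : E d ≡ D - d u - d v
      Ed = E-value d

      Ex : ∀ p → E (x p) ≡ d p - x p u - x p v
      Ex p = E-value (x p)

      Exᵗ : ∀ p → E (λ q → x q p) ≡ d p - x u p - x v p
      Exᵗ p = trans (E-value (λ q → x q p)) (cong (λ s → s - x u p - x v p)
        (∑-cong (allFin n) λ q → cong (χ q *_) (x-sym q p)))

      row : ∀ p → ∑ᵛ (λ q → σ q * (1ℚ - δ p q) * Y p q)
        ≡ κ * (D - κ * d p) - κ * (D - d u - d v) + κ * (κ - 1ℚ) * (d p - x p u - x p v)
          - σ p * (D - 2ℚ * κ * d p)
      row p = begin
        ∑ᵛ (λ q → σ q * (1ℚ - δ p q) * Y p q)
          ≡⟨ ∑-cong (allFin n) (λ q → solve 7 (λ s e D k a b y →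
                 s :* (con 1ℚ :- e) :* (D :- k :* (a :+ b) :+ k :* (k :- con 1ℚ) :* y)
                 := s :* ((D :- k :* a) :+ (con 0ℚ :- k) :* b :+ k :* (k :- con 1ℚ) :* y)
                    :- e :* (s :* (D :- k :* (a :+ b) :+ k :* (k :- con 1ℚ) :* y)))
               refl (σ q) (δ p q) D κ (d p) (d q) (x p q)) ⟩
        ∑ᵛ (λ q → σ q * ((D - κ * d p) + (0ℚ - κ) * d q + κ * (κ - 1ℚ) * x p q) - δ p q * (σ q * Y p q))
          ≡⟨ ∑-- (allFin n) (λ q → σ q * ((D - κ * d p) + (0ℚ - κ) * d q + κ * (κ - 1ℚ) * x p q)) (λ q → δ p q * (σ q * Y p q)) ⟩
        ∑ᵛ (λ q → σ q * ((D - κ * d p) + (0ℚ - κ) * d q + κ * (κ - 1ℚ) * x p q)) - ∑ᵛ (λ q → δ p q * (σ q * Y p q))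
          ≡⟨ cong₂ _-_ (∑-affine (allFin n) σ d (x p) (D - κ * d p) (0ℚ - κ) (κ * (κ - 1ℚ))) (∑ᵛ-δ p (λ q → σ q * Y p q)) ⟩
        (D - κ * d p) * ∑ᵛ σ + (0ℚ - κ) * E d + κ * (κ - 1ℚ) * E (x p) - σ p * Y p p
          ≡⟨ cong₂ _-_ (cong₂ _+_ (cong₂ (λ a b → (D - κ * d p) * a + (0ℚ - κ) * b) ∑σ Ed) (cong (κ * (κ - 1ℚ) *_) (Ex p)))
                       (cong (λ y → σ p * (D - κ * (d p + d p) + κ * (κ - 1ℚ) * y)) (x-irr p)) ⟩
        (D - κ * d p) * κ + (0ℚ - κ) * (D - d u - d v) + κ * (κ - 1ℚ) * (d p - x p u - x p v)
          - σ p * (D - κ * (d p + d p) + κ * (κ - 1ℚ) * 0ℚ)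
          ≡⟨ solve 8 (λ D k a s du dv y z →
               (D :- k :* a) :* k :+ (con 0ℚ :- k) :* (D :- du :- dv) :+ k :* (k :- con 1ℚ) :* (a :- y :- z)
                 :- s :* (D :- k :* (a :+ a) :+ k :* (k :- con 1ℚ) :* con 0ℚ)
               := k :* (D :- k :* a) :- k :* (D :- du :- dv) :+ k :* (k :- con 1ℚ) :* (a :- y :- z)
                 :- s :* (D :- con 2ℚ :* k :* a)) refl D κ (d p) (σ p) (d u) (d v) (x p u) (x p v) ⟩
        κ * (D - κ * d p) - κ * (D - d u - d v) + κ * (κ - 1ℚ) * (d p - x p u - x p v)
          - σ p * (D - 2ℚ * κ * d p) ∎
        where open ≡-Reasoning

    -- The κ-cliques through uv together carry exactly `x u v`. The factor 2 appears because each
    -- omitted pair is met in both orders, and κ(κ-1) is the denominator cleared from `Y`.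
    ∑σσY : ∑ᵛ (λ p → ∑ᵛ (λ q → σ p * σ q * (1ℚ - δ p q) * Y p q)) ≡ 2ℚ * (κ * (κ - 1ℚ)) * x u v
    ∑σσY = begin
      ∑ᵛ (λ p → ∑ᵛ (λ q → σ p * σ q * (1ℚ - δ p q) * Y p q))
        ≡⟨ ∑-cong (allFin n) (λ p → trans
             (∑-cong (allFin n) λ q → solve 4 (λ a b c y → a :* b :* c :* y := a :* (b :* c :* y)) refl (σ p) (σ q) (1ℚ - δ p q) (Y p q))
             (trans (∑-*ˡ (allFin n) (σ p) (λ q → σ q * (1ℚ - δ p q) * Y p q)) (cong (σ p *_) (row p)))) ⟩
      ∑ᵛ (λ p → σ p * (κ * (D - κ * d p) - κ * (D - d u - d v) + κ * (κ - 1ℚ) * (d p - x p u - x p v) - σ p * (D - 2ℚ * κ * d p)))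
        ≡⟨ ∑-cong (allFin n) (λ p → σ-collect p (d p) (x p u) (x p v)) ⟩
      ∑ᵛ (λ p → σ p * (A + κ * d p + (0ℚ - κ * (κ - 1ℚ)) * (x p u + x p v)))
        ≡⟨ ∑-affine (allFin n) σ d (λ p → x p u + x p v) A κ (0ℚ - κ * (κ - 1ℚ)) ⟩
      A * ∑ᵛ σ + κ * E d + (0ℚ - κ * (κ - 1ℚ)) * E (λ p → x p u + x p v)
        ≡⟨ cong₂ _+_ (cong₂ (λ a b → A * a + κ * b) ∑σ Ed) (cong ((0ℚ - κ * (κ - 1ℚ)) *_) Exx) ⟩
      A * κ + κ * (D - d u - d v) + (0ℚ - κ * (κ - 1ℚ)) * ((d u - 0ℚ - x u v) + (d v - x u v - 0ℚ))
        ≡⟨ solve 5 (λ D k du dv y →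
             (k :* D :- k :* (D :- du :- dv) :- D) :* k :+ k :* (D :- du :- dv)
               :+ (con 0ℚ :- k :* (k :- con 1ℚ)) :* ((du :- con 0ℚ :- y) :+ (dv :- y :- con 0ℚ))
             := con 2ℚ :* (k :* (k :- con 1ℚ)) :* y) refl D κ (d u) (d v) (x u v) ⟩
      2ℚ * (κ * (κ - 1ℚ)) * x u v ∎
      where
      open ≡-Reasoning
      A : ℚ
      A = κ * D - κ * (D - d u - d v) - D
      -- The diagonal correction carries a second factor `σ p`; idempotence absorbs it, and the
      -- summand becomes affine in `d p` and the `x` terms.
      σ-collect : ∀ p a y z →
        σ p * (κ * (D - κ * a) - κ * (D - d u - d v) + κ * (κ - 1ℚ) * (a - y - z) - σ p * (D - 2ℚ * κ * a))
          ≡ σ p * (A + κ * a + (0ℚ - κ * (κ - 1ℚ)) * (y + z))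
      σ-collect p a y z = begin
        σ p * (κ * (D - κ * a) - κ * (D - d u - d v) + κ * (κ - 1ℚ) * (a - y - z) - σ p * (D - 2ℚ * κ * a))
          ≡⟨ solve 3 (λ s B C → s :* (B :- s :* C) := s :* B :- s :* s :* C) refl (σ p)
               (κ * (D - κ * a) - κ * (D - d u - d v) + κ * (κ - 1ℚ) * (a - y - z)) (D - 2ℚ * κ * a) ⟩
        σ p * (κ * (D - κ * a) - κ * (D - d u - d v) + κ * (κ - 1ℚ) * (a - y - z)) - σ p * σ p * (D - 2ℚ * κ * a)
          ≡⟨ cong (λ t → σ p * (κ * (D - κ * a) - κ * (D - d u - d v) + κ * (κ - 1ℚ) * (a - y - z)) - t * (D - 2ℚ * κ * a)) (σ-idem p) ⟩
        σ p * (κ * (D - κ * a) - κ * (D - d u - d v) + κ * (κ - 1ℚ) * (a - y - z)) - σ p * (D - 2ℚ * κ * a)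
          ≡⟨ solve 8 (λ s D k a du dv y z →
               s :* (k :* (D :- k :* a) :- k :* (D :- du :- dv) :+ k :* (k :- con 1ℚ) :* (a :- y :- z)) :- s :* (D :- con 2ℚ :* k :* a)
               := s :* ((k :* D :- k :* (D :- du :- dv) :- D) :+ k :* a :+ (con 0ℚ :- k :* (k :- con 1ℚ)) :* (y :+ z)))
               refl (σ p) D κ a (d u) (d v) y z ⟩
        σ p * (A + κ * a + (0ℚ - κ * (κ - 1ℚ)) * (y + z)) ∎
      Exx : E (λ p → x p u + x p v) ≡ (d u - 0ℚ - x u v) + (d v - x u v - 0ℚ)
      Exx = begin
        E (λ p → x p u + x p v)
          ≡⟨ ∑-cong (allFin n) (λ p → ℚₚ.*-distribˡ-+ (σ p) (x p u) (x p v)) ⟩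
        ∑ᵛ (λ p → σ p * x p u + σ p * x p v)
          ≡⟨ ∑-+ (allFin n) (λ p → σ p * x p u) (λ p → σ p * x p v) ⟩
        E (λ p → x p u) + E (λ p → x p v)
          ≡⟨ cong₂ _+_ (Exᵗ u) (Exᵗ v) ⟩
        (d u - x u u - x v u) + (d v - x u v - x v v)
          ≡⟨ cong₂ _+_ (cong₂ (λ a b → d u - a - b) (x-irr u) (x-sym v u)) (cong (λ a → d v - x u v - a) (x-irr v)) ⟩
        (d u - 0ℚ - x u v) + (d v - x u v - 0ℚ) ∎

  module Nonnegativity
    {m M : ℚ}
    (0≤κ : 0ℚ ≤ᵠ κ) (0≤κ-1 : 0ℚ ≤ᵠ κ - 1ℚ)
    (ratio : (κ * κ + κ) * M ≤ᵠ (κ * κ + κ + 1ℚ) * m)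
    (χ-01 : ∀ p → χ p ≡ 0ℚ ⊎ χ p ≡ 1ℚ)
    (x-irr : ∀ p → x p p ≡ 0ℚ)
    (m≤x : ∀ p q → p ≢ q → χ p ≡ 1ℚ → χ q ≡ 1ℚ → m ≤ᵠ x p q)
    (x≤M : ∀ p q → p ≢ q → χ p ≡ 1ℚ → χ q ≡ 1ℚ → x p q ≤ᵠ M)
    (size : ∑ᵛ χ ≡ κ + 2ℚ)
    where

    private
      -- `χ - δ p` is the indicator of the κ+1 clique vertices other than `p`. Comparing with a
      -- constant on them turns bounds on single edges into bounds on `d p`.
      others : ∀ {p} → χ p ≡ 1ℚ → ∀ c → ∑ᵛ (λ q → (χ q - δ p q) * c) ≡ (κ + 1ℚ) * c
      others {p} χp c = begin
        ∑ᵛ (λ q → (χ q - δ p q) * c)         ≡⟨ ∑-*ʳ (allFin n) c (λ q → χ q - δ p q) ⟩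
        ∑ᵛ (λ q → χ q - δ p q) * c           ≡⟨ cong (_* c) (∑-- (allFin n) χ (δ p)) ⟩
        (∑ᵛ χ - ∑ᵛ (δ p)) * c                ≡⟨ cong₂ (λ a b → (a - b) * c) size
                                                  (trans (∑-cong (allFin n) λ q → ≡-sym (ℚₚ.*-identityʳ (δ p q))) (∑ᵛ-δ p (λ _ → 1ℚ))) ⟩
        (κ + 2ℚ - 1ℚ) * c                    ≡⟨ solve 2 (λ k c → (k :+ con 2ℚ :- con 1ℚ) :* c := (k :+ con 1ℚ) :* c) refl κ c ⟩
        (κ + 1ℚ) * c                         ∎
        where open ≡-Reasoning

      d-lower : ∀ {p} → χ p ≡ 1ℚ → (κ + 1ℚ) * m ≤ᵠ d p
      d-lower {p} χp = subst (_≤ᵠ d p) (others χp m) (∑-mono (allFin n) term)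
        where
        term : ∀ q → (χ q - δ p q) * m ≤ᵠ χ q * x p q
        term q with p ≟ q | χ-01 q
        ... | yes refl | _ rewrite χp | x-irr p = ℚₚ.≤-reflexive (solve 1 (λ m → (con 1ℚ :- con 1ℚ) :* m := con 0ℚ) refl m)
        ... | no _   | inj₁ χq rewrite χq = ℚₚ.≤-reflexive (solve 2 (λ m y → (con 0ℚ :- con 0ℚ) :* m := con 0ℚ :* y) refl m (x p q))
        ... | no p≢q | inj₂ χq rewrite χq = subst₂ _≤ᵠ_ (≡-sym (ℚₚ.*-identityˡ m)) (≡-sym (ℚₚ.*-identityˡ (x p q))) (m≤x p q p≢q χp χq)

      d-upper : ∀ {p} → χ p ≡ 1ℚ → d p ≤ᵠ (κ + 1ℚ) * M
      d-upper {p} χp = subst (d p ≤ᵠ_) (others χp M) (∑-mono (allFin n) term)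
        where
        term : ∀ q → χ q * x p q ≤ᵠ (χ q - δ p q) * M
        term q with p ≟ q | χ-01 q
        ... | yes refl | _ rewrite χp | x-irr p = ℚₚ.≤-reflexive (solve 1 (λ m → con 0ℚ := (con 1ℚ :- con 1ℚ) :* m) refl M)
        ... | no _   | inj₁ χq rewrite χq = ℚₚ.≤-reflexive (solve 2 (λ m y → con 0ℚ :* y := (con 0ℚ :- con 0ℚ) :* m) refl M (x p q))
        ... | no p≢q | inj₂ χq rewrite χq = subst₂ _≤ᵠ_ (≡-sym (ℚₚ.*-identityˡ (x p q))) (≡-sym (ℚₚ.*-identityˡ M)) (x≤M p q p≢q χp χq)

      D-lower : (κ + 2ℚ) * ((κ + 1ℚ) * m) ≤ᵠ D
      D-lower = subst (_≤ᵠ D) (trans (∑-*ʳ (allFin n) ((κ + 1ℚ) * m) χ) (cong (_* ((κ + 1ℚ) * m)) size))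
        (∑-mono (allFin n) term)
        where
        term : ∀ p → χ p * ((κ + 1ℚ) * m) ≤ᵠ χ p * d p
        term p with χ-01 p
        ... | inj₁ χp rewrite χp = ℚₚ.≤-reflexive (trans (ℚₚ.*-zeroˡ ((κ + 1ℚ) * m)) (≡-sym (ℚₚ.*-zeroˡ (d p))))
        ... | inj₂ χp = *-monoʳ-≤ (subst (0ℚ ≤ᵠ_) (≡-sym χp) 0≤1) (d-lower χp)

    0≤Y : ∀ {p q} → p ≢ q → χ p ≡ 1ℚ → χ q ≡ 1ℚ → 0ℚ ≤ᵠ Y p q
    0≤Y {p} {q} p≢q χp χq = subst (0ℚ ≤ᵠ_)
      -- `Y p q` as a nonnegative combination of the slacks in `D-lower`, `d-upper` at both ends,
      -- `m≤x` and `ratio`. The terms in m cancel because (κ+2)(κ+1) + κ(κ-1) = 2(κ²+κ+1).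
      (solve 7 (λ k D a b y m M →
          (D :- (k :+ con 2ℚ) :* ((k :+ con 1ℚ) :* m)) :+ k :* (((k :+ con 1ℚ) :* M :- a) :+ ((k :+ con 1ℚ) :* M :- b))
            :+ k :* (k :- con 1ℚ) :* (y :- m)
            :+ con 2ℚ :* ((k :* k :+ k :+ con 1ℚ) :* m :- (k :* k :+ k) :* M)
          := D :- k :* (a :+ b) :+ k :* (k :- con 1ℚ) :* y) refl κ D (d p) (d q) (x p q) m M)
      (0≤p+q (0≤p+q (0≤p+q (p≤q⇒0≤q-p D-lower)
        (0≤p*q 0≤κ (0≤p+q (p≤q⇒0≤q-p (d-upper χp)) (p≤q⇒0≤q-p (d-upper χq)))))
        (0≤p*q (0≤p*q 0≤κ 0≤κ-1) (p≤q⇒0≤q-p (m≤x p q p≢q χp χq))))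
        (0≤p*q (0≤p+q 0≤1 0≤1) (p≤q⇒0≤q-p ratio)))

-- Subsets and cliques

χ : ∀ {n} → Subset n → Fin n → ℚ
χ S i = ⟦ lookup S i ⟧

χ-idem : ∀ {n} (S : Subset n) i → χ S i * χ S i ≡ χ S i
χ-idem S i with lookup S i
... | true  = refl
... | false = refl

mem-lookup : ∀ {n} i (S : Subset n) → mem i S ≡ lookup S i
mem-lookup i S with lookup S i
... | true  = refl
... | false = refl

∑χ : ∀ {n} (S : Subset n) → ∑ᵛ (χ S) ≡ fromℕ ∣ S ∣
∑χ []          = refl
∑χ (true ∷ S)  = trans (∑ᵛ-suc (χ (true ∷ S))) (trans (cong (1ℚ +_) (∑χ S)) (≡-sym (fromℕ-suc ∣ S ∣)))
∑χ (false ∷ S) = trans (∑ᵛ-suc (χ (false ∷ S))) (trans (cong (0ℚ +_) (∑χ S)) (ℚₚ.+-identityˡ (fromℕ ∣ S ∣)))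

insert remove : ∀ {n} → Fin n → Subset n → Subset n
insert p S = S [ p ]≔ inside
remove p S = S [ p ]≔ outside

∣insert∣ : ∀ {n} (p : Fin n) S → lookup S p ≡ outside → ∣ insert p S ∣ ≡ suc ∣ S ∣
∣insert∣ zero    (_ ∷ S)     refl = refl
∣insert∣ (suc p) (true ∷ S)  e    = cong suc (∣insert∣ p S e)
∣insert∣ (suc p) (false ∷ S) e    = ∣insert∣ p S e

∣remove∣ : ∀ {n} (p : Fin n) S → lookup S p ≡ inside → suc ∣ remove p S ∣ ≡ ∣ S ∣
∣remove∣ zero    (_ ∷ S)     refl = refl
∣remove∣ (suc p) (true ∷ S)  e    = cong suc (∣remove∣ p S e)
∣remove∣ (suc p) (false ∷ S) e    = ∣remove∣ p S e

χ-remove : ∀ {n} (p i : Fin n) S → χ (remove p S) i ≡ χ S i * (1ℚ - δ i p)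
χ-remove p i S with i ≟ p
... | yes refl = trans (cong ⟦_⟧ (lookup∘update p S outside)) (≡-sym (ℚₚ.*-zeroʳ (χ S i)))
... | no  i≢p  = trans (cong ⟦_⟧ (lookup∘update′ i≢p S outside)) (≡-sym (ℚₚ.*-identityʳ (χ S i)))

∈-remove : ∀ {n} (p i : Fin n) S → lookup (remove p S) i ≡ true → lookup S i ≡ true
∈-remove p i S e with i ≟ p
... | yes refl = contradiction (trans (≡-sym e) (lookup∘update p S outside)) λ ()
... | no  i≢p  = trans (≡-sym (lookup∘update′ i≢p S outside)) e

∈-insert : ∀ {n} (p i : Fin n) S → lookup (insert p S) i ≡ true → i ≢ p → lookup S i ≡ true
∈-insert p i S e i≢p = trans (≡-sym (lookup∘update′ i≢p S inside)) e

ι : ∀ {n} → Subset n → Subset n → ℚ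
ι S J = ⟦ ⌊ S ⊆? J ⌋ ⟧

ι-⊆ : ∀ {n} {S J : Subset n} → S ⊆ J → ι S J ≡ 1ℚ
ι-⊆ {S = S} {J} S⊆J with S ⊆? J
... | yes _   = refl
... | no  S⊈J = ⊥-elim (S⊈J S⊆J)

-- Containment becomes a product with one factor per inserted vertex, so a count of supersets can be
-- summed over the new vertex.
ι-insert : ∀ {n} (p : Fin n) S J → ι (insert p S) J ≡ ι S J * χ J p
ι-insert p S J with insert p S ⊆? J | S ⊆? J | lookup J p in Jp
... | yes _ | yes _ | true  = refl
... | no  _ | yes _ | false = refl
... | no  _ | no  _ | true  = refl
... | no  _ | no  _ | false = refl
... | yes i⊆ | _     | false = contradiction (trans (≡-sym Jp) ([]=⇒lookup (i⊆ (lookup⇒[]= p _ (lookup∘update p S inside))))) λ ()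
... | yes i⊆ | no S⊈ | true  = ⊥-elim (S⊈ S⊆)
  where
  S⊆ : S ⊆ J
  S⊆ {x} x∈S with x ≟ p
  ... | yes refl = lookup⇒[]= x J Jp
  ... | no  x≢p  = i⊆ (lookup⇒[]= x _ (trans (lookup∘update′ x≢p S inside) ([]=⇒lookup x∈S)))
... | no  i⊈ | yes S⊆ | true = ⊥-elim (i⊈ i⊆)
  where
  i⊆ : insert p S ⊆ J
  i⊆ {x} x∈ with x ≟ p
  ... | yes refl = lookup⇒[]= x J Jp
  ... | no  x≢p  = S⊆ (lookup⇒[]= x S (∈-insert p x S ([]=⇒lookup x∈) x≢p))

⊆∧∣∣≡⇒≡ : ∀ {n} {S J : Subset n} → S ⊆ J → ∣ S ∣ ≡ ∣ J ∣ → J ≡ S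
⊆∧∣∣≡⇒≡ {S = S} {J} S⊆J e = ⊆-antisym J⊆S S⊆J
  where
  J⊆S : J ⊆ S
  J⊆S {x} x∈J with x ∈? S
  ... | yes x∈S = x∈S
  ... | no  x∉S = contradiction (p⊂q⇒∣p∣<∣q∣ ((λ {y} → S⊆J {y}) , x , x∈J , x∉S)) (ℕₚ.<-irrefl e)

-- The Boolean clique test and its meaning

allB⇒ : ∀ {A : Set} (p : A → Bool) {xs x} → allB p xs ≡ true → x ∈ˡ xs → p x ≡ true
allB⇒ p {x ∷ xs} e x∈ with p x in px
allB⇒ p {x ∷ xs} e (here refl) | true = px
allB⇒ p {x ∷ xs} e (there x∈)  | true = allB⇒ p e x∈

⇒allB : ∀ {A : Set} (p : A → Bool) xs → (∀ x → p x ≡ true) → allB p xs ≡ true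
⇒allB p []       h = refl
⇒allB p (x ∷ xs) h rewrite h x = ⇒allB p xs h

Clique : ∀ {n} → Graph n → Subset n → Set
Clique G S = ∀ i j → lookup S i ≡ true → lookup S j ≡ true → i ≢ j → Edge G i j

module _ {n} (G : Graph n) where

  isClique⇒Clique : ∀ S → isClique G S ≡ true → Clique G S
  isClique⇒Clique S e i j i∈S j∈S i≢j
    with pair ← allB⇒ _ (allB⇒ _ e (∈-allFin i)) (∈-allFin j)
    rewrite mem-lookup i S | mem-lookup j S | i∈S | j∈S with i ≟ j
  ... | yes i≡j = contradiction i≡j i≢j
  ... | no  _   = pair

  Clique⇒isClique : ∀ S → Clique G S → isClique G S ≡ true
  Clique⇒isClique S c = ⇒allB _ (allFin n) λ i → ⇒allB _ (allFin n) (pair i)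
    where
    pair : ∀ i j → not (mem i S ∧ mem j S) ∨ ⌊ i ≟ j ⌋ ∨ adj G i j ≡ true
    pair i j rewrite mem-lookup i S | mem-lookup j S with lookup S i in i∈S | lookup S j in j∈S | i ≟ j
    ... | false | _     | _       = refl
    ... | true  | false | _       = refl
    ... | true  | true  | yes _   = refl
    ... | true  | true  | no  i≢j = c i j i∈S j∈S i≢j

  isKkCopy⇒ : ∀ r S → isKkCopy r G S ≡ true → ∣ S ∣ ≡ r × Clique G S
  isKkCopy⇒ r S e with s , c ← Equivalence.to T-∧ (Equivalence.from T-≡ e) =
    ℕₚ.≡ᵇ⇒≡ ∣ S ∣ r s , isClique⇒Clique S (Equivalence.to T-≡ c)

  ⇒isKkCopy : ∀ r S → ∣ S ∣ ≡ r → Clique G S → isKkCopy r G S ≡ true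
  ⇒isKkCopy r S s c = Equivalence.to T-≡ (Equivalence.from T-∧
    (ℕₚ.≡⇒≡ᵇ ∣ S ∣ r s , Equivalence.from T-≡ (Clique⇒isClique S c)))

  remove-Clique : ∀ p S → Clique G S → Clique G (remove p S)
  remove-Clique p S c i j i∈ j∈ = c i j (∈-remove p i S i∈) (∈-remove p j S j∈)

  insert-Clique : ∀ p S → Clique G S → (∀ t → lookup S t ≡ true → Edge G t p) → Clique G (insert p S)
  insert-Clique p S c h i j i∈ j∈ i≢j with i ≟ p | j ≟ p
  ... | yes refl | yes refl = contradiction refl i≢j
  ... | yes refl | no  j≢p  = trans (Graph.sym G i j) (h j (∈-insert p j S j∈ j≢p))
  ... | no  i≢p  | yes refl = h i (∈-insert p i S i∈ i≢p)
  ... | no  i≢p  | no  j≢p  = c i j (∈-insert p i S i∈ i≢p) (∈-insert p j S j∈ j≢p) i≢j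

-- Counting the cliques that extend a given clique

module CliqueCount {n} (G : Graph n) (r : ℕ) where

  copy : Subset n → ℚ
  copy J = ⟦ isKkCopy r G J ⟧

  N : Subset n → ℚ
  N S = ∑ (subsets n) (λ J → copy J * ι S J)

  N-nonneg : ∀ S → 0ℚ ≤ᵠ N S
  N-nonneg S = ∑-nonneg (subsets n) λ J → 0≤p*q (0≤⟦⟧ (isKkCopy r G J)) (0≤⟦⟧ ⌊ S ⊆? J ⌋)

  -- The only `r`-set containing an `r`-set is that set itself, so the count degenerates to an
  -- indicator. This is the base case of both bounds.
  N-full : ∀ S → ∣ S ∣ ≡ r → N S ≡ copy S
  N-full S e = trans (∑-cong (subsets n) same) (∑-δˢ S copy)
    where
    same : ∀ J → copy J * ι S J ≡ copy J * δˢ J S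
    same J with isKkCopy r G J in J-copy
    ... | false = trans (ℚₚ.*-zeroˡ (ι S J)) (≡-sym (ℚₚ.*-zeroˡ (δˢ J S)))
    ... | true with S ⊆? J | ≡-dec _≟ᴮ_ J S
    ...   | yes _   | yes _    = refl
    ...   | no  _   | no  _    = refl
    ...   | yes S⊆J | no  J≢S  = contradiction (⊆∧∣∣≡⇒≡ S⊆J (trans e (≡-sym (proj₁ (isKkCopy⇒ G r J J-copy))))) J≢S
    ...   | no  S⊈J | yes refl = ⊥-elim (S⊈J ⊆-refl)

  -- Double counting of the pairs of an `r`-clique J containing S and a vertex p of J outside S:
  -- each J offers r - ∣S∣ = j + 1 such vertices.
  N-extend : ∀ S j → ∣ S ∣ ℕ.+ suc j ≡ r →
    ∑ᵛ (λ p → (1ℚ - χ S p) * N (insert p S)) ≡ fromℕ (suc j) * N S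
  N-extend S j e = begin
    ∑ᵛ (λ p → (1ℚ - χ S p) * N (insert p S))
      ≡⟨ ∑-*-swap (allFin n) (subsets n) (λ p → 1ℚ - χ S p) (λ J p → copy J * ι (insert p S) J) ⟩
    ∑ (subsets n) (λ J → ∑ᵛ (λ p → (1ℚ - χ S p) * (copy J * ι (insert p S) J)))
      ≡⟨ ∑-cong (subsets n) (λ J → trans
           (∑-cong (allFin n) λ p → trans (cong (λ i → (1ℚ - χ S p) * (copy J * i)) (ι-insert p S J))
             (solve 4 (λ a b c d → (con 1ℚ :- a) :* (b :* (c :* d)) := b :* c :* (d :- a :* d)) refl (χ S p) (copy J) (ι S J) (χ J p)))
           (trans (∑-*ˡ (allFin n) (copy J * ι S J) (λ p → χ J p - χ S p * χ J p)) (inner J))) ⟩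
    ∑ (subsets n) (λ J → fromℕ (suc j) * (copy J * ι S J))
      ≡⟨ ∑-*ˡ (subsets n) (fromℕ (suc j)) (λ J → copy J * ι S J) ⟩
    fromℕ (suc j) * N S ∎
    where
    open ≡-Reasoning
    inner : ∀ J → copy J * ι S J * ∑ᵛ (λ p → χ J p - χ S p * χ J p) ≡ fromℕ (suc j) * (copy J * ι S J)
    inner J with isKkCopy r G J in J-copy | S ⊆? J
    ... | false | b     = solve 3 (λ b x y → con 0ℚ :* b :* x := y :* (con 0ℚ :* b)) refl ⟦ ⌊ b ⌋ ⟧ (∑ᵛ (λ p → χ J p - χ S p * χ J p)) (fromℕ (suc j))
    ... | true  | no  _ = solve 2 (λ x y → con 0ℚ :* x := y :* con 0ℚ) refl (∑ᵛ (λ p → χ J p - χ S p * χ J p)) (fromℕ (suc j))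
    ... | true  | yes S⊆J = begin
      1ℚ * ∑ᵛ (λ p → χ J p - χ S p * χ J p)     ≡⟨ ℚₚ.*-identityˡ _ ⟩
      ∑ᵛ (λ p → χ J p - χ S p * χ J p)          ≡⟨ ∑-cong (allFin n) (λ p → cong (λ a → χ J p - a) (absorb p)) ⟩
      ∑ᵛ (λ p → χ J p - χ S p)                  ≡⟨ ∑-- (allFin n) (χ J) (χ S) ⟩
      ∑ᵛ (χ J) - ∑ᵛ (χ S)                       ≡⟨ cong₂ _-_ (trans (∑χ J) (cong fromℕ (trans (proj₁ (isKkCopy⇒ G r J J-copy)) (≡-sym e)))) (∑χ S) ⟩
      fromℕ (∣ S ∣ ℕ.+ suc j) - fromℕ ∣ S ∣     ≡⟨ cong (_- fromℕ ∣ S ∣) (fromℕ-+ ∣ S ∣ (suc j)) ⟩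
      fromℕ ∣ S ∣ + fromℕ (suc j) - fromℕ ∣ S ∣ ≡⟨ solve 2 (λ a b → a :+ b :- a := b :* con 1ℚ) refl (fromℕ ∣ S ∣) (fromℕ (suc j)) ⟩
      fromℕ (suc j) * 1ℚ                        ∎
      where
      absorb : ∀ p → χ S p * χ J p ≡ χ S p
      absorb p with lookup S p in Sp
      ... | false = ℚₚ.*-zeroˡ (χ J p)
      ... | true rewrite []=⇒lookup (S⊆J (lookup⇒[]= p S Sp)) = refl

  private
    ν : ℚ
    ν = fromℕ n

    -- Multiplication by j! passes from cliques to ordered ways of extending S one vertex at a time.
    -- Both bounds then become inductions on j without division.
    factorial-step : ∀ S j → ∣ S ∣ ℕ.+ suc j ≡ r →
      fromℕ (suc j ℕ.!) * N S ≡ ∑ᵛ (λ p → (1ℚ - χ S p) * (fromℕ (j ℕ.!) * N (insert p S)))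
    factorial-step S j e = begin
      fromℕ (suc j ℕ.!) * N S
        ≡⟨ cong (_* N S) (fromℕ-* (suc j) (j ℕ.!)) ⟩
      fromℕ (suc j) * fromℕ (j ℕ.!) * N S
        ≡⟨ solve 3 (λ a b c → a :* b :* c := b :* (a :* c)) refl (fromℕ (suc j)) (fromℕ (j ℕ.!)) (N S) ⟩
      fromℕ (j ℕ.!) * (fromℕ (suc j) * N S)
        ≡⟨ cong (fromℕ (j ℕ.!) *_) (N-extend S j e) ⟨
      fromℕ (j ℕ.!) * ∑ᵛ (λ p → (1ℚ - χ S p) * N (insert p S))
        ≡⟨ ∑-*ˡ (allFin n) (fromℕ (j ℕ.!)) (λ p → (1ℚ - χ S p) * N (insert p S)) ⟨
      ∑ᵛ (λ p → fromℕ (j ℕ.!) * ((1ℚ - χ S p) * N (insert p S)))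
        ≡⟨ ∑-cong (allFin n) (λ p → solve 3 (λ a b c → b :* (a :* c) := a :* (b :* c)) refl (1ℚ - χ S p) (fromℕ (j ℕ.!)) (N (insert p S))) ⟩
      ∑ᵛ (λ p → (1ℚ - χ S p) * (fromℕ (j ℕ.!) * N (insert p S))) ∎
      where open ≡-Reasoning

    grow : ∀ (p : Fin n) S j → lookup S p ≡ outside → ∣ S ∣ ℕ.+ suc j ≡ r → ∣ insert p S ∣ ℕ.+ j ≡ r
    grow p S j p∉S e = trans (cong (ℕ._+ j) (∣insert∣ p S p∉S)) (trans (≡-sym (ℕₚ.+-suc ∣ S ∣ j)) e)

    0≤ν^ : ∀ j → 0ℚ ≤ᵠ ν ^ j
    0≤ν^ zero    = 0≤1
    0≤ν^ (suc j) = 0≤p*q (0≤fromℕ n) (0≤ν^ j)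

  -- Each of the `j` successive extensions has at most `n` candidates.
  N-upper : ∀ j S → ∣ S ∣ ℕ.+ j ≡ r → fromℕ (j ℕ.!) * N S ≤ᵠ ν ^ j
  N-upper zero S e = subst (_≤ᵠ 1ℚ)
      (≡-sym (trans (ℚₚ.*-identityˡ (N S)) (N-full S (trans (≡-sym (ℕₚ.+-identityʳ ∣ S ∣)) e)))) (copy≤1 S)
    where
    copy≤1 : ∀ S → copy S ≤ᵠ 1ℚ
    copy≤1 S with isKkCopy r G S
    ... | true  = ℚₚ.≤-refl
    ... | false = 0≤1
  N-upper (suc j) S e = subst₂ _≤ᵠ_ (≡-sym (factorial-step S j e)) (∑ᵛ-const n (ν ^ j)) (∑-mono (allFin n) term)
    where
    term : ∀ p → (1ℚ - χ S p) * (fromℕ (j ℕ.!) * N (insert p S)) ≤ᵠ ν ^ j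
    term p with lookup S p in Sp
    ... | true  = subst (_≤ᵠ ν ^ j) (≡-sym (ℚₚ.*-zeroˡ (fromℕ (j ℕ.!) * N (insert p S)))) (0≤ν^ j)
    ... | false = subst (_≤ᵠ ν ^ j) (≡-sym (ℚₚ.*-identityˡ (fromℕ (j ℕ.!) * N (insert p S)))) (N-upper j (insert p S) (grow p S j Sp e))

  -- `b` bounds the non-neighbours of a vertex, itself included. By `room`, at least a fraction `θ`
  -- of all vertices survives when those of `r` vertices are discarded.
  module _ {θ b : ℚ} (0≤θ : 0ℚ ≤ᵠ θ) (0≤b : 0ℚ ≤ᵠ b)
    (nonneighbours : ∀ v → ∑ᵛ (λ p → 1ℚ - ⟦ adj G v p ⟧) ≤ᵠ b)
    (room : ν * θ ≤ᵠ ν - fromℕ r * b) where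

    private
      -- The union bound in linear form: `1 - missing S p` is 1 if `p` is adjacent to all of S and
      -- at most 0 otherwise, so it never exceeds the indicator of the admissible extensions.
      missing : Subset n → Fin n → ℚ
      missing S p = ∑ᵛ (λ t → χ S t * (1ℚ - ⟦ adj G t p ⟧))

      0≤1-⟦⟧ : ∀ c → 0ℚ ≤ᵠ 1ℚ - ⟦ c ⟧
      0≤1-⟦⟧ true  = ℚₚ.≤-refl
      0≤1-⟦⟧ false = 0≤1

      0≤missing-term : ∀ S p t → 0ℚ ≤ᵠ χ S t * (1ℚ - ⟦ adj G t p ⟧)
      0≤missing-term S p t = 0≤p*q (0≤⟦⟧ (lookup S t)) (0≤1-⟦⟧ (adj G t p))

      1≤missing : ∀ S p t → lookup S t ≡ true → adj G t p ≡ false → 1ℚ ≤ᵠ missing S p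
      1≤missing S p t St tp = subst (_≤ᵠ missing S p) (∑ᵛ-δ t (λ _ → 1ℚ)) (∑-mono (allFin n) term)
        where
        term : ∀ q → δ t q * 1ℚ ≤ᵠ χ S q * (1ℚ - ⟦ adj G q p ⟧)
        term q with t ≟ q
        ... | yes refl rewrite St | tp = ℚₚ.≤-refl
        ... | no  _    = 0≤missing-term S p q

      ∑missing : ∀ S j → ∣ S ∣ ℕ.+ j ≡ r → ν - fromℕ r * b ≤ᵠ ∑ᵛ (λ p → 1ℚ - missing S p)
      ∑missing S j e = subst (ν - fromℕ r * b ≤ᵠ_)
        (≡-sym (trans (∑-- (allFin n) (λ _ → 1ℚ) (missing S)) (cong (_- ∑ᵛ (missing S)) (trans (∑ᵛ-const n 1ℚ) (ℚₚ.*-identityʳ ν)))))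
        (ℚₚ.+-monoʳ-≤ ν (ℚₚ.neg-antimono-≤ (begin
          ∑ᵛ (missing S)
            ≡⟨ ∑-swap (allFin n) (allFin n) (λ p t → χ S t * (1ℚ - ⟦ adj G t p ⟧)) ⟩
          ∑ᵛ (λ t → ∑ᵛ (λ p → χ S t * (1ℚ - ⟦ adj G t p ⟧)))
            ≤⟨ ∑-mono (allFin n) (λ t → ℚₚ.≤-trans
                 (ℚₚ.≤-reflexive (∑-*ˡ (allFin n) (χ S t) (λ p → 1ℚ - ⟦ adj G t p ⟧)))
                 (*-monoʳ-≤ (0≤⟦⟧ (lookup S t)) (nonneighbours t))) ⟩
          ∑ᵛ (λ t → χ S t * b)
            ≡⟨ trans (∑-*ʳ (allFin n) b (χ S)) (cong (_* b) (∑χ S)) ⟩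
          fromℕ ∣ S ∣ * b
            ≡⟨ ℚₚ.*-comm (fromℕ ∣ S ∣) b ⟩
          b * fromℕ ∣ S ∣
            -- Replacing ∣S∣ by its upper bound `r` gives the same factor `θ` at every level of the
            -- induction.
            ≤⟨ *-monoʳ-≤ 0≤b (fromℕ-mono (subst (∣ S ∣ ≤_) e (ℕₚ.m≤m+n ∣ S ∣ j))) ⟩
          b * fromℕ r
            ≡⟨ ℚₚ.*-comm b (fromℕ r) ⟩
          fromℕ r * b ∎)))
        where open ℚₚ.≤-Reasoning

      0≤lower : ∀ j → 0ℚ ≤ᵠ (ν * θ) ^ j
      0≤lower zero    = 0≤1
      0≤lower (suc j) = 0≤p*q (0≤p*q (0≤fromℕ n) 0≤θ) (0≤lower j)

    -- By the union bound at least νθ vertices are adjacent to all of S, and adding any of them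
    -- leaves a clique to which the induction applies.
    N-lower : ∀ j S → Clique G S → ∣ S ∣ ℕ.+ j ≡ r → (ν * θ) ^ j ≤ᵠ fromℕ (j ℕ.!) * N S
    N-lower zero S c e = ℚₚ.≤-reflexive (≡-sym (trans (ℚₚ.*-identityˡ (N S)) (trans (N-full S ∣S∣≡r) (cong ⟦_⟧ (⇒isKkCopy G r S ∣S∣≡r c)))))
      where
      ∣S∣≡r : ∣ S ∣ ≡ r
      ∣S∣≡r = trans (≡-sym (ℕₚ.+-identityʳ ∣ S ∣)) e
    N-lower (suc j) S c e = begin
      ν * θ * L
        ≡⟨ ℚₚ.*-comm (ν * θ) L ⟩
      L * (ν * θ)
        ≤⟨ *-monoʳ-≤ (0≤lower j) (ℚₚ.≤-trans room (∑missing S (suc j) e)) ⟩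
      L * ∑ᵛ (λ p → 1ℚ - missing S p)
        ≡⟨ ∑-*ˡ (allFin n) L (λ p → 1ℚ - missing S p) ⟨
      ∑ᵛ (λ p → L * (1ℚ - missing S p))
        ≤⟨ ∑-mono (allFin n) term ⟩
      ∑ᵛ (λ p → (1ℚ - χ S p) * (fromℕ (j ℕ.!) * N (insert p S)))
        ≡⟨ factorial-step S j e ⟨
      fromℕ (suc j ℕ.!) * N S ∎
      where
      open ℚₚ.≤-Reasoning
      L : ℚ
      L = (ν * θ) ^ j
      term : ∀ p → L * (1ℚ - missing S p) ≤ᵠ (1ℚ - χ S p) * (fromℕ (j ℕ.!) * N (insert p S))
      term p with any? (λ t → lookup S t ≟ᴮ true ×-dec adj G t p ≟ᴮ false)
      -- A non-neighbour `t` in S makes the left side at most 0, while the right side is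
      -- nonnegative.
      ... | yes (t , St , tp) = ℚₚ.≤-trans
        (subst (L * (1ℚ - missing S p) ≤ᵠ_) (ℚₚ.*-zeroʳ L)
          (*-monoʳ-≤ (0≤lower j) (subst (1ℚ - missing S p ≤ᵠ_) (ℚₚ.+-inverseʳ 1ℚ) (ℚₚ.+-monoʳ-≤ 1ℚ (ℚₚ.neg-antimono-≤ (1≤missing S p t St tp))))))
        (0≤p*q (0≤1-⟦⟧ (lookup S p)) (0≤p*q (0≤fromℕ (j ℕ.!)) (N-nonneg (insert p S))))
      ... | no none = ℚₚ.≤-trans
        (subst (L * (1ℚ - missing S p) ≤ᵠ_) (ℚₚ.*-identityʳ L)
          (*-monoʳ-≤ (0≤lower j) (ℚₚ.+-monoʳ-≤ 1ℚ (ℚₚ.neg-antimono-≤ (∑-nonneg (allFin n) (0≤missing-term S p))))))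
        (subst (L ≤ᵠ_) (trans (≡-sym (ℚₚ.*-identityˡ _)) (cong (λ c → (1ℚ - ⟦ c ⟧) * (fromℕ (j ℕ.!) * N (insert p S))) (≡-sym p∉S)))
          (N-lower j (insert p S) (insert-Clique G p S c joined) (grow p S j p∉S e)))
        where
        joined : ∀ t → lookup S t ≡ true → adj G t p ≡ true
        joined t St with adj G t p in tp
        ... | true  = refl
        ... | false = contradiction (t , St , tp) none
        -- No vertex is its own neighbour, so adjacency to all of S already keeps `p` out of S.
        p∉S : lookup S p ≡ false
        p∉S with lookup S p in Sp
        ... | false = refl
        ... | true  = contradiction (trans (≡-sym (joined p Sp)) (irrefl G p)) λ ()

-- The weighting of the k-cliques

δ-sym : ∀ {n} (i j : Fin n) → δ i j ≡ δ j i
δ-sym i j with i ≟ j | j ≟ i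
... | yes _   | yes _   = refl
... | no  _   | no  _   = refl
... | yes i≡j | no  j≢i = contradiction (≡-sym i≡j) j≢i
... | no  i≢j | yes j≡i = contradiction (≡-sym j≡i) i≢j

pairCount : ∀ {n} → Graph n → ℕ → Fin n → Fin n → ℚ
pairCount {n} G r u v = ∑ (subsets n) (λ J → ⟦ isKkCopy r G J ⟧ * (χ J u * χ J v))

pairCount-sym : ∀ {n} (G : Graph n) r u v → pairCount G r u v ≡ pairCount G r v u
pairCount-sym {n} G r u v = ∑-cong (subsets n) λ J → cong (⟦ isKkCopy r G J ⟧ *_) (ℚₚ.*-comm (χ J u) (χ J v))

-- `c` is 1/(2κ(κ-1)): the denominator of the clique formula, doubled because omitted pairs are
-- summed as ordered pairs.
module Decomposition {n} (G : Graph n) (k : ℕ) (1≤k : 1 ≤ k) {c : ℚ} (0≤c : 0ℚ ≤ᵠ c)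
  (c-inv : 2ℚ * (fromℕ k * (fromℕ k - 1ℚ)) * c ≡ 1ℚ)
  (x : Fin n → Fin n → ℚ)
  (x-sym : ∀ p q → x p q ≡ x q p)
  (x-irr : ∀ p → x p p ≡ 0ℚ)
  (x-inv : ∀ p q → Edge G p q → x p q * pairCount G (suc (suc k)) p q ≡ 1ℚ)
  {m M : ℚ}
  (m≤x : ∀ p q → Edge G p q → m ≤ᵠ x p q)
  (x≤M : ∀ p q → Edge G p q → x p q ≤ᵠ M)
  (ratio : (fromℕ k * fromℕ k + fromℕ k) * M ≤ᵠ (fromℕ k * fromℕ k + fromℕ k + 1ℚ) * m)
  where

  private
    r : ℕ
    r = suc (suc k)

    κ : ℚ
    κ = fromℕ k

    copy : Subset n → ℚ
    copy J = ⟦ isKkCopy r G J ⟧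

    Y : Subset n → Fin n → Fin n → ℚ
    Y J = WeightedClique.Y κ (χ J) x

    size : ∀ J → isKkCopy r G J ≡ true → ∑ᵛ (χ J) ≡ κ + 2ℚ
    size J e = begin
      ∑ᵛ (χ J)                ≡⟨ ∑χ J ⟩
      fromℕ ∣ J ∣             ≡⟨ cong fromℕ (proj₁ (isKkCopy⇒ G r J e)) ⟩
      fromℕ (suc (suc k))     ≡⟨ fromℕ-+ 2 k ⟩
      2ℚ + κ                  ≡⟨ ℚₚ.+-comm 2ℚ κ ⟩
      κ + 2ℚ                  ∎
      where open ≡-Reasoning

    pairs : Subset n → Fin n → Fin n → ℚ
    pairs J p q = χ J p * χ J q * (1ℚ - δ p q)

    without : Fin n → Fin n → Subset n → Subset n
    without p q J = remove q (remove p J)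

    -- What J passes on to the clique left after omitting `p` and `q`, up to the factor `c`. The
    -- indicators make it 0 unless J is a (k+2)-clique with `p`, `q` distinct in it, so sums may
    -- range over all J, p and q.
    B : Subset n → Fin n → Fin n → ℚ
    B J p q = copy J * (pairs J p q * Y J p q)

    χ-01 : ∀ (J : Subset n) p → χ J p ≡ 0ℚ ⊎ χ J p ≡ 1ℚ
    χ-01 J p with lookup J p
    ... | true  = inj₂ refl
    ... | false = inj₁ refl

    χ≡1⇒∈ : ∀ (J : Subset n) p → χ J p ≡ 1ℚ → lookup J p ≡ true
    χ≡1⇒∈ J p e with lookup J p
    ... | true  = refl

    0≤B : ∀ J p q → 0ℚ ≤ᵠ B J p q
    0≤B J p q with isKkCopy r G J in J-copy | lookup J p in Jp | lookup J q in Jq | p ≟ q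
    ... | false | a     | b     | e     = ℚₚ.≤-reflexive (≡-sym (ℚₚ.*-zeroˡ (⟦ a ⟧ * ⟦ b ⟧ * (1ℚ - ⟦ ⌊ e ⌋ ⟧) * Y J p q)))
    ... | true  | false | b     | e     = ℚₚ.≤-reflexive (solve 3 (λ b e y → con 0ℚ := con 1ℚ :* (con 0ℚ :* b :* e :* y)) refl ⟦ b ⟧ (1ℚ - ⟦ ⌊ e ⌋ ⟧) (Y J p q))
    ... | true  | true  | false | e     = ℚₚ.≤-reflexive (solve 2 (λ e y → con 0ℚ := con 1ℚ :* (con 1ℚ :* con 0ℚ :* e :* y)) refl (1ℚ - ⟦ ⌊ e ⌋ ⟧) (Y J p q))
    ... | true  | true  | true  | yes _ = ℚₚ.≤-reflexive (solve 1 (λ y → con 0ℚ := con 1ℚ :* (con 1ℚ :* con 1ℚ :* (con 1ℚ :- con 1ℚ) :* y)) refl (Y J p q))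
    ... | true  | true  | true  | no p≢q = subst (0ℚ ≤ᵠ_) (solve 1 (λ y → y := con 1ℚ :* (con 1ℚ :* con 1ℚ :* (con 1ℚ :- con 0ℚ) :* y)) refl (Y J p q))
      (WeightedClique.Nonnegativity.0≤Y κ (χ J) x (0≤fromℕ k) (p≤q⇒0≤q-p (fromℕ-mono 1≤k)) ratio (χ-01 J) x-irr
        (λ p q p≢q χp χq → m≤x p q (edge p q p≢q χp χq)) (λ p q p≢q χp χq → x≤M p q (edge p q p≢q χp χq)) (size J J-copy)
        p≢q (cong ⟦_⟧ Jp) (cong ⟦_⟧ Jq))
      where
      edge : ∀ p q → p ≢ q → χ J p ≡ 1ℚ → χ J q ≡ 1ℚ → Edge G p q
      edge p q p≢q χp χq = proj₂ (isKkCopy⇒ G r J J-copy) p q (χ≡1⇒∈ J p χp) (χ≡1⇒∈ J q χq) p≢q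

  weight : Subset n → ℚ
  weight S = c * ∑ (subsets n) (λ J → ∑ᵛ λ p → ∑ᵛ λ q → B J p q * δˢ S (without p q J))

  0≤weight : ∀ S → 0ℚ ≤ᵠ weight S
  0≤weight S = 0≤p*q 0≤c (∑-nonneg (subsets n) λ J → ∑-nonneg (allFin n) λ p → ∑-nonneg (allFin n) λ q →
    0≤p*q (0≤B J p q) (0≤⟦⟧ ⌊ ≡-dec _≟ᴮ_ S (without p q J) ⌋))

  module _ {u v : Fin n} (uv : Edge G u v) where

    private
      u≢v : u ≢ v
      u≢v refl = contradiction (trans (≡-sym uv) (irrefl G u)) λ ()

      A : Subset n → ℚ
      A S = ⟦ isKkCopy k G S ⟧ * (χ S u * χ S v)

      -- Definitionally the `σ` of the clique identity. That module presupposes `u` and `v` in the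
      -- clique, whereas `s` is available for every J.
      s : Subset n → Fin n → ℚ
      s J p = χ J p * (1ℚ - δ u p) * (1ℚ - δ v p)

      χ-without : ∀ p q i J → χ (without p q J) i ≡ χ J i * (1ℚ - δ i p) * (1ℚ - δ i q)
      χ-without p q i J = trans (χ-remove q i (remove p J)) (cong (_* (1ℚ - δ i q)) (χ-remove p i J))

      without-copy : ∀ J {p q} → isKkCopy r G J ≡ true → p ≢ q → lookup J p ≡ true → lookup J q ≡ true →
        isKkCopy k G (without p q J) ≡ true
      without-copy J {p} {q} e p≢q Jp Jq with ∣J∣ , c ← isKkCopy⇒ G r J e =
        ⇒isKkCopy G k (without p q J)
          (ℕₚ.suc-injective (trans (∣remove∣ q (remove p J) (trans (lookup∘update′ (λ q≡p → p≢q (≡-sym q≡p)) J outside) Jq))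
            (ℕₚ.suc-injective (trans (∣remove∣ p J Jp) ∣J∣))))
          (remove-Clique G q (remove p J) (remove-Clique G p J c))

      -- What remains of J contains uv exactly when J does and `p`, `q` avoid `u` and `v`; the edge
      -- indicator thus moves into the two factors `s`.
      pairs-A : ∀ J p q → isKkCopy r G J ≡ true →
        pairs J p q * Y J p q * A (without p q J) ≡ χ J u * χ J v * (s J p * s J q * (1ℚ - δ p q) * Y J p q)
      pairs-A J p q e with lookup J p in Jp | lookup J q in Jq | p ≟ q
      ... | false | b | d = solve 9 (λ b d y a u v s t w → con 0ℚ :* b :* d :* y :* a := u :* v :* (con 0ℚ :* s :* t :* w :* d :* y)) refl
        ⟦ b ⟧ (1ℚ - ⟦ ⌊ d ⌋ ⟧) (Y J p q) (A (without p q J)) (χ J u) (χ J v) (1ℚ - δ u p) (1ℚ - δ v p) (⟦ b ⟧ * (1ℚ - δ u q) * (1ℚ - δ v q))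
      ... | true  | false | d = solve 9 (λ d y a u v s t w z → con 1ℚ :* con 0ℚ :* d :* y :* a := u :* v :* (s :* (con 0ℚ :* w :* z) :* d :* y)) refl
        (1ℚ - ⟦ ⌊ d ⌋ ⟧) (Y J p q) (A (without p q J)) (χ J u) (χ J v) (1ℚ * (1ℚ - δ u p) * (1ℚ - δ v p)) 0ℚ (1ℚ - δ u q) (1ℚ - δ v q)
      ... | true  | true  | yes _ = solve 6 (λ y a u v s t → con 1ℚ :* con 1ℚ :* (con 1ℚ :- con 1ℚ) :* y :* a := u :* v :* (s :* t :* (con 1ℚ :- con 1ℚ) :* y)) refl
        (Y J p q) (A (without p q J)) (χ J u) (χ J v) (1ℚ * (1ℚ - δ u p) * (1ℚ - δ v p)) (1ℚ * (1ℚ - δ u q) * (1ℚ - δ v q))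
      ... | true  | true  | no p≢q = trans
        (cong (λ a → 1ℚ * 1ℚ * (1ℚ - 0ℚ) * Y J p q * a)
          (cong₂ _*_ (cong ⟦_⟧ (without-copy J e p≢q Jp Jq)) (cong₂ _*_ (χ-without p q u J) (χ-without p q v J))))
        (solve 7 (λ y u v a b c d →
            con 1ℚ :* con 1ℚ :* (con 1ℚ :- con 0ℚ) :* y :* (con 1ℚ :* ((u :* a :* b) :* (v :* c :* d)))
            := u :* v :* ((con 1ℚ :* a :* c) :* (con 1ℚ :* b :* d) :* (con 1ℚ :- con 0ℚ) :* y)) refl
          (Y J p q) (χ J u) (χ J v) (1ℚ - δ u p) (1ℚ - δ u q) (1ℚ - δ v p) (1ℚ - δ v q))

      X : ℚ
      X = 2ℚ * (κ * (κ - 1ℚ)) * x u v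

      -- The share of a single J in the weight on uv: the clique identity if J contains the edge,
      -- and 0 on both sides otherwise.
      local : ∀ J → ∑ᵛ (λ p → ∑ᵛ λ q → B J p q * A (without p q J)) ≡ X * (copy J * (χ J u * χ J v))
      local J = begin
        ∑ᵛ (λ p → ∑ᵛ λ q → B J p q * A (without p q J))
          ≡⟨ ∑-cong (allFin n) (λ p → trans
               (∑-cong (allFin n) λ q → ℚₚ.*-assoc (copy J) (pairs J p q * Y J p q) (A (without p q J)))
               (∑-*ˡ (allFin n) (copy J) (λ q → pairs J p q * Y J p q * A (without p q J)))) ⟩
        ∑ᵛ (λ p → copy J * ∑ᵛ λ q → pairs J p q * Y J p q * A (without p q J))
          ≡⟨ ∑-*ˡ (allFin n) (copy J) (λ p → ∑ᵛ λ q → pairs J p q * Y J p q * A (without p q J)) ⟩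
        copy J * ∑ᵛ (λ p → ∑ᵛ λ q → pairs J p q * Y J p q * A (without p q J))
          ≡⟨ on-copies ⟩
        X * (copy J * (χ J u * χ J v)) ∎
        where
        open ≡-Reasoning
        ∑ss : ℚ
        ∑ss = ∑ᵛ (λ p → ∑ᵛ λ q → s J p * s J q * (1ℚ - δ p q) * Y J p q)
        through : isKkCopy r G J ≡ true → χ J u * χ J v * ∑ss ≡ X * (1ℚ * (χ J u * χ J v))
        through e with lookup J u in Ju | lookup J v in Jv
        ... | false | b     = solve 3 (λ v x y → con 0ℚ :* v :* y := x :* (con 1ℚ :* (con 0ℚ :* v))) refl ⟦ b ⟧ X ∑ss
        ... | true  | false = solve 2 (λ x y → con 1ℚ :* con 0ℚ :* y := x :* (con 1ℚ :* (con 1ℚ :* con 0ℚ))) refl X ∑ss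
        ... | true  | true  = begin
          1ℚ * 1ℚ * ∑ss             ≡⟨ ℚₚ.*-identityˡ ∑ss ⟩
          ∑ss                       ≡⟨ WeightedClique.Identity.∑σσY κ (χ J) x x-sym x-irr (χ-idem J) (size J e) u≢v (cong ⟦_⟧ Ju) (cong ⟦_⟧ Jv) ⟩
          X                         ≡⟨ ℚₚ.*-identityʳ X ⟨
          X * (1ℚ * (1ℚ * 1ℚ))      ∎
        on-copies : copy J * ∑ᵛ (λ p → ∑ᵛ λ q → pairs J p q * Y J p q * A (without p q J)) ≡ X * (copy J * (χ J u * χ J v))
        on-copies with isKkCopy r G J in e
        ... | false = solve 3 (λ a b c → con 0ℚ :* a := b :* (con 0ℚ :* c)) refl
                        (∑ᵛ (λ p → ∑ᵛ λ q → pairs J p q * Y J p q * A (without p q J))) X (χ J u * χ J v)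
        ... | true  = begin
          1ℚ * ∑ᵛ (λ p → ∑ᵛ λ q → pairs J p q * Y J p q * A (without p q J))
            ≡⟨ ℚₚ.*-identityˡ _ ⟩
          ∑ᵛ (λ p → ∑ᵛ λ q → pairs J p q * Y J p q * A (without p q J))
            ≡⟨ ∑-cong (allFin n) (λ p → trans (∑-cong (allFin n) λ q → pairs-A J p q e)
                 (∑-*ˡ (allFin n) (χ J u * χ J v) (λ q → s J p * s J q * (1ℚ - δ p q) * Y J p q))) ⟩
          ∑ᵛ (λ p → χ J u * χ J v * ∑ᵛ λ q → s J p * s J q * (1ℚ - δ p q) * Y J p q)
            ≡⟨ ∑-*ˡ (allFin n) (χ J u * χ J v) (λ p → ∑ᵛ λ q → s J p * s J q * (1ℚ - δ p q) * Y J p q) ⟩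
          χ J u * χ J v * ∑ss
            ≡⟨ through e ⟩
          X * (1ℚ * (χ J u * χ J v)) ∎

      select : ∀ J p q → ∑ (subsets n) (λ S → A S * (B J p q * δˢ S (without p q J))) ≡ B J p q * A (without p q J)
      select J p q = trans
        (∑-cong (subsets n) λ S → solve 3 (λ a b d → a :* (b :* d) := b :* a :* d) refl (A S) (B J p q) (δˢ S (without p q J)))
        (∑-δˢ (without p q J) (λ S → B J p q * A S))

    -- Once the sums are exchanged, every (k+2)-clique through uv delivers `x u v`, and `x-inv` says
    -- that these deliveries add up to 1.
    edge-sum : sumℚ (map weight (copiesThrough k G u v)) ≡ 1ℚ
    edge-sum = begin
      ∑ (copiesThrough k G u v) weight
        ≡⟨ ∑-filterB (λ S → mem u S ∧ mem v S) (copies k G) weight ⟩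
      ∑ (copies k G) (λ S → ⟦ mem u S ∧ mem v S ⟧ * weight S)
        ≡⟨ ∑-filterB (isKkCopy k G) (subsets n) (λ S → ⟦ mem u S ∧ mem v S ⟧ * weight S) ⟩
      ∑ (subsets n) (λ S → ⟦ isKkCopy k G S ⟧ * (⟦ mem u S ∧ mem v S ⟧ * weight S))
        ≡⟨ ∑-cong (subsets n) (λ S → trans
             (cong (λ t → ⟦ isKkCopy k G S ⟧ * (t * weight S))
               (trans (⟦⟧-∧ (mem u S) (mem v S)) (cong₂ (λ a b → ⟦ a ⟧ * ⟦ b ⟧) (mem-lookup u S) (mem-lookup v S))))
             (solve 4 (λ a b c d → a :* (b :* (c :* d)) := c :* (a :* b :* d)) refl
               ⟦ isKkCopy k G S ⟧ (χ S u * χ S v) c (∑ (subsets n) (λ J → ∑ᵛ λ p → ∑ᵛ λ q → B J p q * δˢ S (without p q J))))) ⟩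
      ∑ (subsets n) (λ S → c * (A S * ∑ (subsets n) (λ J → ∑ᵛ λ p → ∑ᵛ λ q → B J p q * δˢ S (without p q J))))
        ≡⟨ ∑-*ˡ (subsets n) c (λ S → A S * ∑ (subsets n) (λ J → ∑ᵛ λ p → ∑ᵛ λ q → B J p q * δˢ S (without p q J))) ⟩
      c * ∑ (subsets n) (λ S → A S * ∑ (subsets n) (λ J → ∑ᵛ λ p → ∑ᵛ λ q → B J p q * δˢ S (without p q J)))
        ≡⟨ cong (c *_) (∑-*-swap (subsets n) (subsets n) A (λ J S → ∑ᵛ λ p → ∑ᵛ λ q → B J p q * δˢ S (without p q J))) ⟩
      c * ∑ (subsets n) (λ J → ∑ (subsets n) λ S → A S * ∑ᵛ λ p → ∑ᵛ λ q → B J p q * δˢ S (without p q J))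
        ≡⟨ cong (c *_) (∑-cong (subsets n) λ J → trans
             (∑-*-swap (subsets n) (allFin n) A (λ p S → ∑ᵛ λ q → B J p q * δˢ S (without p q J)))
             (∑-cong (allFin n) λ p → trans
               (∑-*-swap (subsets n) (allFin n) A (λ q S → B J p q * δˢ S (without p q J)))
               (∑-cong (allFin n) (select J p)))) ⟩
      c * ∑ (subsets n) (λ J → ∑ᵛ λ p → ∑ᵛ λ q → B J p q * A (without p q J))
        ≡⟨ cong (c *_) (trans (∑-cong (subsets n) local) (∑-*ˡ (subsets n) X (λ J → copy J * (χ J u * χ J v)))) ⟩
      c * (X * pairCount G r u v)
        ≡⟨ solve 4 (λ c K x N → c :* (K :* x :* N) := K :* c :* (x :* N)) refl c (2ℚ * (κ * (κ - 1ℚ))) (x u v) (pairCount G r u v) ⟩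
      2ℚ * (κ * (κ - 1ℚ)) * c * (x u v * pairCount G r u v)
        ≡⟨ cong₂ _*_ c-inv (x-inv u v uv) ⟩
      1ℚ * 1ℚ ∎
      where open ≡-Reasoning

  decomposition : FractionalDecomposition k G
  decomposition = weight , All.universal (λ S → 0≤weight S) (copies k G) , λ i j → edge-sum

-- The numerical estimates

*-distribʳ-^ : ∀ a b j → (a * b) ^ j ≡ a ^ j * b ^ j
*-distribʳ-^ a b zero    = refl
*-distribʳ-^ a b (suc j) = trans (cong (a * b *_) (*-distribʳ-^ a b j))
  (solve 4 (λ a b c d → a :* b :* (c :* d) := a :* c :* (b :* d)) refl a b (a ^ j) (b ^ j))

0<^ : ∀ {a} → 0ℚ <ᵠ a → ∀ j → 0ℚ <ᵠ a ^ j
0<^ 0<a zero    = ℚₚ.positive⁻¹ 1ℚ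
0<^ 0<a (suc j) = 0<p*q 0<a (0<^ 0<a j)

bernoulli : ∀ {a} → 0ℚ ≤ᵠ a → 0ℚ ≤ᵠ 1ℚ - a → ∀ j → 1ℚ - fromℕ j * a ≤ᵠ (1ℚ - a) ^ j
bernoulli {a} 0≤a 0≤1-a zero    = ℚₚ.≤-reflexive (solve 1 (λ a → con 1ℚ :- con 0ℚ :* a := con 1ℚ) refl a)
bernoulli {a} 0≤a 0≤1-a (suc j) = begin
  1ℚ - fromℕ (suc j) * a                          ≡⟨ cong (λ s → 1ℚ - s * a) (fromℕ-suc j) ⟩
  1ℚ - (1ℚ + fromℕ j) * a                         ≡⟨ ℚₚ.+-identityʳ _ ⟨
  1ℚ - (1ℚ + fromℕ j) * a + 0ℚ                    ≤⟨ ℚₚ.+-monoʳ-≤ (1ℚ - (1ℚ + fromℕ j) * a) (0≤p*q (0≤fromℕ j) (0≤p*q 0≤a 0≤a)) ⟩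
  1ℚ - (1ℚ + fromℕ j) * a + fromℕ j * (a * a)     ≡⟨ solve 2 (λ a j → con 1ℚ :- (con 1ℚ :+ j) :* a :+ j :* (a :* a)
                                                       := (con 1ℚ :- a) :* (con 1ℚ :- j :* a)) refl a (fromℕ j) ⟩
  (1ℚ - a) * (1ℚ - fromℕ j * a)                   ≤⟨ *-monoʳ-≤ 0≤1-a (bernoulli 0≤a 0≤1-a j) ⟩
  (1ℚ - a) * (1ℚ - a) ^ j                         ∎
  where open ℚₚ.≤-Reasoning

-- Total, with default 0, so that edge weights can be defined on all pairs before any clique count
-- is known to be positive.
recip : ℚ → ℚ
recip p with 0ℚ <? p
... | yes 0<p = proj₁ (inverse 0<p)
... | no  _   = 0ℚ

0≤recip : ∀ p → 0ℚ ≤ᵠ recip p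
0≤recip p with 0ℚ <? p
... | yes 0<p = proj₁ (proj₂ (inverse 0<p))
... | no  _   = ℚₚ.≤-refl

*-recip : ∀ {p} → 0ℚ <ᵠ p → p * recip p ≡ 1ℚ
*-recip {p} 0<p with 0ℚ <? p
... | yes 0<p′ = proj₂ (proj₂ (inverse 0<p′))
... | no  p≤0  = contradiction 0<p p≤0

unit-fraction-inverse : ∀ d → .{{_ : ℕ.NonZero d}} → (pos 1 / d) * fromℕ d ≡ 1ℚ
unit-fraction-inverse d@(suc d-1) = ℚₚ.toℚᵘ-injective (begin
  toℚᵘ ((pos 1 / d) * fromℕ d)                 ≈⟨ ℚₚ.toℚᵘ-homo-* (pos 1 / d) (fromℕ d) ⟩
  toℚᵘ (pos 1 / d) ℚᵘ.* toℚᵘ (fromℕ d)         ≈⟨ ℚᵘₚ.*-cong (ℚₚ.toℚᵘ-fromℚᵘ (ℚᵘ.mkℚᵘ (pos 1) d-1)) (fromℕ-toℚᵘ d) ⟩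
  ℚᵘ.mkℚᵘ (pos 1) d-1 ℚᵘ.* ℚᵘ.mkℚᵘ (pos d) 0                 ≈⟨ ℚᵘ.*≡* (cong pos (identity d)) ⟩
  toℚᵘ 1ℚ                                                    ∎)
  where
  open ℚᵘₚ.≃-Reasoning
  identity : ∀ d → 1 ℕ.* d ℕ.* 1 ≡ 1 ℕ.* (d ℕ.* 1)
  identity = solve-∀ᴺ

inv9k10-inverse : ∀ k → 1 ≤ k → inv9k10 k * fromℕ (9 ℕ.* k ℕ.^ 10) ≡ 1ℚ
inv9k10-inverse (suc k) _ = unit-fraction-inverse (9 ℕ.* suc k ℕ.^ 10) {{m*n≢0 9 (suc k ℕ.^ 10) {{_}} {{m^n≢0 (suc k) 10}}}}

0<inv9k10 : ∀ k → 1 ≤ k → 0ℚ <ᵠ inv9k10 k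
0<inv9k10 (suc k) _ = ℚₚ.positive⁻¹ _ {{ℚₚ.normalize-pos 1 (9 ℕ.* suc k ℕ.^ 10) {{nz}}}}
  where
  nz : ℕ.NonZero (9 ℕ.* suc k ℕ.^ 10)
  nz = m*n≢0 9 (suc k ℕ.^ 10) {{_}} {{m^n≢0 (suc k) 10}}

-- The quotient of the largest by the smallest pair count is at most
-- 1/(1 − k(k+2)ε), and the decomposition of K_{k+2} tolerates 1 + 1/(k²+k).
k+3≤9k¹⁰ : ∀ k → 3 ≤ k → suc (suc (suc k)) ≤ 9 ℕ.* k ℕ.^ 10
k+3≤9k¹⁰ k 3≤k = begin
  3 ℕ.+ k              ≤⟨ ℕₚ.+-monoˡ-≤ k 3≤k ⟩
  k ℕ.+ k              ≤⟨ ℕₚ.m≤m+n (k ℕ.+ k) (7 ℕ.* k) ⟩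
  k ℕ.+ k ℕ.+ 7 ℕ.* k  ≡⟨ identity k ⟩
  9 ℕ.* (k ℕ.* 1)      ≤⟨ ℕₚ.*-monoʳ-≤ 9 (^-monoʳ-≤ k {{ℕ.>-nonZero (ℕₚ.≤-trans (ℕ.s≤s ℕ.z≤n) 3≤k)}} {1} {10} (ℕ.s≤s ℕ.z≤n)) ⟩
  9 ℕ.* k ℕ.^ 10       ∎
  where
  open ℕₚ.≤-Reasoning
  identity : ∀ k → k ℕ.+ k ℕ.+ 7 ℕ.* k ≡ 9 ℕ.* (k ℕ.* 1)
  identity = solve-∀ᴺ

-- Here k + 2 ≤ 3k and k² + k + 1 ≤ 3k² produce the constant 9. The outcome is k(k+2)ε ≤ 1/(k²+k+1),
-- the loss that the clique decomposition can bear.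
k⟨k+2⟩⟨k²+k+1⟩≤9k¹⁰ : ∀ k → 3 ≤ k → k ℕ.* (2 ℕ.+ k) ℕ.* (k ℕ.* k ℕ.+ k ℕ.+ 1) ≤ 9 ℕ.* k ℕ.^ 10
k⟨k+2⟩⟨k²+k+1⟩≤9k¹⁰ k 3≤k = begin
  k ℕ.* (2 ℕ.+ k) ℕ.* (k ℕ.* k ℕ.+ k ℕ.+ 1)
    ≤⟨ ℕₚ.*-mono-≤ (ℕₚ.*-monoʳ-≤ k (ℕₚ.+-monoˡ-≤ k (ℕₚ.*-monoʳ-≤ 2 1≤k)))
         (ℕₚ.+-mono-≤ (ℕₚ.+-monoʳ-≤ (k ℕ.* k) (ℕₚ.m≤m*n k k {{ℕ.>-nonZero 1≤k}})) (ℕₚ.*-mono-≤ 1≤k 1≤k)) ⟩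
  k ℕ.* (2 ℕ.* k ℕ.+ k) ℕ.* (k ℕ.* k ℕ.+ k ℕ.* k ℕ.+ k ℕ.* k)
    ≡⟨ identity k ⟩
  9 ℕ.* k ℕ.^ 4
    ≤⟨ ℕₚ.*-monoʳ-≤ 9 (^-monoʳ-≤ k {{ℕ.>-nonZero 1≤k}} (ℕₚ.m≤m+n 4 6)) ⟩
  9 ℕ.* k ℕ.^ 10 ∎
  where
  open ℕₚ.≤-Reasoning
  1≤k : 1 ≤ k
  1≤k = ℕₚ.≤-trans (ℕ.s≤s ℕ.z≤n) 3≤k
  identity : ∀ k → k ℕ.* (2 ℕ.* k ℕ.+ k) ℕ.* (k ℕ.* k ℕ.+ k ℕ.* k ℕ.+ k ℕ.* k) ≡ 9 ℕ.* (k ℕ.* (k ℕ.* (k ℕ.* (k ℕ.* 1))))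
  identity = solve-∀ᴺ

∑-count : ∀ {A : Set} (p : A → Bool) xs → ∑ xs (λ x → ⟦ p x ⟧) ≡ fromℕ (count (map p xs))
∑-count p []       = refl
∑-count p (x ∷ xs) with p x
... | true  = trans (cong (1ℚ +_) (∑-count p xs)) (≡-sym (fromℕ-suc (count (map p xs))))
... | false = trans (ℚₚ.+-identityˡ _) (∑-count p xs)

pairCount-N : ∀ {n} (G : Graph n) r u v → pairCount G r u v ≡ CliqueCount.N G r (insert v (insert u ⊥))
pairCount-N {n} G r u v = ∑-cong (subsets n) λ J → cong (⟦ isKkCopy r G J ⟧ *_) (begin
  χ J u * χ J v                      ≡⟨ cong (_* χ J v) (ℚₚ.*-identityˡ (χ J u)) ⟨
  1ℚ * χ J u * χ J v                 ≡⟨ cong (λ i → i * χ J u * χ J v) (ι-⊆ {S = ⊥} {J} ⊥⊆) ⟨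
  ι ⊥ J * χ J u * χ J v              ≡⟨ cong (_* χ J v) (ι-insert u ⊥ J) ⟨
  ι (insert u ⊥) J * χ J v           ≡⟨ ι-insert v (insert u ⊥) J ⟨
  ι (insert v (insert u ⊥)) J        ∎)
  where open ≡-Reasoning

module _ {n} (G : Graph n) {u v : Fin n} (uv : Edge G u v) where

  private
    lookup-⊥ : ∀ (i : Fin n) → lookup ⊥ i ≡ outside
    lookup-⊥ i = lookup-replicate i outside

    u≢v : u ≢ v
    u≢v refl = contradiction (trans (≡-sym uv) (irrefl G u)) λ ()

  edge-Clique : Clique G (insert v (insert u ⊥))
  edge-Clique = insert-Clique G v (insert u ⊥)
    (insert-Clique G u ⊥ (λ i _ i∈ → empty i i∈) (λ t t∈ → empty t t∈)) λ t t∈ → joined t t∈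
    where
    empty : ∀ {A : Set} (i : Fin n) → lookup ⊥ i ≡ true → A
    empty i i∈ = contradiction (trans (≡-sym i∈) (lookup-⊥ i)) λ ()
    joined : ∀ t → lookup (insert u ⊥) t ≡ true → Edge G t v
    joined t t∈ with t ≟ u
    ... | yes refl = uv
    ... | no  t≢u  = empty t (∈-insert u t ⊥ t∈ t≢u)

  edge-size : ∣ insert v (insert u ⊥) ∣ ≡ 2
  edge-size = begin
    ∣ insert v (insert u ⊥) ∣     ≡⟨ ∣insert∣ v (insert u ⊥) (trans (lookup∘update′ (λ v≡u → u≢v (≡-sym v≡u)) ⊥ inside) (lookup-⊥ v)) ⟩
    suc ∣ insert u ⊥ ∣            ≡⟨ cong suc (∣insert∣ u ⊥ (lookup-⊥ u)) ⟩
    suc (suc ∣ ⊥ {n} ∣)           ≡⟨ cong (2 ℕ.+_) (∣⊥∣≡0 n) ⟩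
    2                             ∎
    where open ≡-Reasoning

-- Graphs of large minimum degree

module Dense (k : ℕ) (3≤k : 3 ≤ k) {n-1 : ℕ} (G : Graph (suc n-1))
  (min-degree : MinDegreeAtLeast G (fromℕ (suc n-1) * (1ℚ - inv9k10 k))) where

  private
    n r : ℕ
    n = suc n-1
    r = suc (suc k)

    1≤k : 1 ≤ k
    1≤k = ℕₚ.≤-trans (ℕ.s≤s ℕ.z≤n) 3≤k

    κ ν ε θ F P Λ : ℚ
    κ = fromℕ k
    ν = fromℕ n
    ε = inv9k10 k
    θ = 1ℚ - fromℕ r * ε
    F = fromℕ (k ℕ.!)
    P = ν ^ k
    Λ = θ ^ k

    0<ε : 0ℚ <ᵠ ε
    0<ε = 0<inv9k10 k 1≤k

    0≤ε : 0ℚ ≤ᵠ ε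
    0≤ε = ℚₚ.<⇒≤ 0<ε

    ε-bound : ∀ {a} → a ≤ 9 ℕ.* k ℕ.^ 10 → fromℕ a * ε ≤ᵠ 1ℚ
    ε-bound {a} a≤ = subst₂ _≤ᵠ_ (ℚₚ.*-comm ε (fromℕ a)) (inv9k10-inverse k 1≤k) (*-monoʳ-≤ 0≤ε (fromℕ-mono a≤))

    0<θ : 0ℚ <ᵠ θ
    -- `θ` subtracts only (k+2)ε; the spare ε in (k+3)ε ≤ 1 gives θ ≥ ε and hence strict positivity.
    0<θ = ℚₚ.<-≤-trans 0<ε (0≤q-p⇒p≤q (subst (0ℚ ≤ᵠ_)
      (trans (cong (λ s → 1ℚ - s * ε) (fromℕ-suc r))
        (solve 2 (λ r e → con 1ℚ :- (con 1ℚ :+ r) :* e := (con 1ℚ :- r :* e) :- e) refl (fromℕ r) ε))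
      (p≤q⇒0≤q-p (ε-bound (k+3≤9k¹⁰ k 3≤k)))))

    0<P : 0ℚ <ᵠ P
    0<P = 0<^ (0<fromℕ n-1) k

    0<Λ : 0ℚ <ᵠ Λ
    0<Λ = 0<^ 0<θ k

    Λ-bound : κ * κ + κ ≤ᵠ (κ * κ + κ + 1ℚ) * Λ
    Λ-bound = begin
      κ * κ + κ
        ≤⟨ 0≤q-p⇒p≤q (subst (0ℚ ≤ᵠ_)
             (trans (cong (λ s → 1ℚ - s * ε) polynomial)
               (solve 3 (λ k r e → con 1ℚ :- k :* r :* (k :* k :+ k :+ con 1ℚ) :* e
                  := (k :* k :+ k :+ con 1ℚ) :* (con 1ℚ :- k :* (r :* e)) :- (k :* k :+ k)) refl κ (fromℕ r) ε))
             (p≤q⇒0≤q-p (ε-bound (k⟨k+2⟩⟨k²+k+1⟩≤9k¹⁰ k 3≤k)))) ⟩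
      (κ * κ + κ + 1ℚ) * (1ℚ - κ * (fromℕ r * ε))
        ≤⟨ *-monoʳ-≤ (0≤p+q (0≤p+q (0≤p*q (0≤fromℕ k) (0≤fromℕ k)) (0≤fromℕ k)) 0≤1)
             (bernoulli (0≤p*q (0≤fromℕ r) 0≤ε) (ℚₚ.<⇒≤ 0<θ) k) ⟩
      (κ * κ + κ + 1ℚ) * Λ ∎
      where
      open ℚₚ.≤-Reasoning
      polynomial : fromℕ (k ℕ.* r ℕ.* (k ℕ.* k ℕ.+ k ℕ.+ 1)) ≡ κ * fromℕ r * (κ * κ + κ + 1ℚ)
      polynomial = trans (fromℕ-* (k ℕ.* r) (k ℕ.* k ℕ.+ k ℕ.+ 1)) (cong₂ _*_ (fromℕ-* k r)
        (trans (fromℕ-+ (k ℕ.* k ℕ.+ k) 1) (cong (_+ 1ℚ) (trans (fromℕ-+ (k ℕ.* k) k) (cong (_+ κ) (fromℕ-* k k))))))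

    nonneighbours : ∀ v → ∑ᵛ (λ p → 1ℚ - ⟦ adj G v p ⟧) ≤ᵠ ν * ε
    nonneighbours v = subst (_≤ᵠ ν * ε)
      (≡-sym (trans (∑-- (allFin n) (λ _ → 1ℚ) (λ p → ⟦ adj G v p ⟧))
        (cong₂ _-_ (trans (∑ᵛ-const n 1ℚ) (ℚₚ.*-identityʳ ν)) (∑-count (adj G v) (allFin n)))))
      (0≤q-p⇒p≤q (subst (0ℚ ≤ᵠ_)
        (solve 3 (λ d n e → d :- n :* (con 1ℚ :- e) := n :* e :- (n :- d)) refl (fromℕ (degree G v)) ν ε)
        (p≤q⇒0≤q-p (min-degree v))))

    module _ {u v : Fin n} (uv : Edge G u v) where

      N : ℚ
      N = pairCount G r u v

      upper : F * N ≤ᵠ P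
      upper = subst (λ c → F * c ≤ᵠ P) (≡-sym (pairCount-N G r u v))
        (CliqueCount.N-upper G r k (insert v (insert u ⊥)) (cong (ℕ._+ k) (edge-size G uv)))

      lower : P * Λ ≤ᵠ F * N
      lower = subst₂ _≤ᵠ_ (*-distribʳ-^ ν θ k) (cong (F *_) (≡-sym (pairCount-N G r u v)))
        (CliqueCount.N-lower G r (ℚₚ.<⇒≤ 0<θ) (0≤p*q (0≤fromℕ n) 0≤ε) nonneighbours
          (ℚₚ.≤-reflexive (solve 3 (λ n r e → n :* (con 1ℚ :- r :* e) := n :- r :* (n :* e)) refl ν (fromℕ r) ε))
          k (insert v (insert u ⊥)) (edge-Clique G uv) (cong (ℕ._+ k) (edge-size G uv)))

      -- Every edge lies in some (k+2)-clique, because the lower bound is strictly positive; only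
      -- then is 1/N(e) a true inverse.
      0<N : 0ℚ <ᵠ N
      0<N = ℚₚ.≰⇒> λ N≤0 → ℚₚ.<-irrefl refl (ℚₚ.<-≤-trans (0<p*q 0<P 0<Λ)
        (ℚₚ.≤-trans lower (subst (F * N ≤ᵠ_) (ℚₚ.*-zeroʳ F) (*-monoʳ-≤ (0≤fromℕ (k ℕ.!)) N≤0))))

    P⁻¹ Λ⁻¹ : ℚ
    P⁻¹ = recip P
    Λ⁻¹ = recip Λ

    -- The first factor handles the diagonal, where `pairCount` counts the cliques through one
    -- vertex and its reciprocal could be nonzero.
    x : Fin n → Fin n → ℚ
    x p q = (1ℚ - δ p q) * recip (pairCount G r p q)

    x-edge : ∀ {p q} → Edge G p q → x p q ≡ recip (pairCount G r p q)
    x-edge {p} {q} pq = trans (cong (λ d → (1ℚ - d) * recip (pairCount G r p q)) (δ-≢ p≢q)) (ℚₚ.*-identityˡ _)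
      where
      p≢q : p ≢ q
      p≢q refl = contradiction (trans (≡-sym pq) (irrefl G p)) λ ()

    x-sym : ∀ p q → x p q ≡ x q p
    x-sym p q = cong₂ (λ d c → (1ℚ - d) * recip c) (δ-sym p q) (pairCount-sym G r p q)

    x-irr : ∀ p → x p p ≡ 0ℚ
    x-irr p = trans (cong (λ d → (1ℚ - d) * recip (pairCount G r p p)) (δ-refl p)) (ℚₚ.*-zeroˡ (recip (pairCount G r p p)))

    x-inv : ∀ p q → Edge G p q → x p q * pairCount G r p q ≡ 1ℚ
    x-inv p q pq = trans (cong (_* pairCount G r p q) (x-edge pq)) (trans (ℚₚ.*-comm _ (pairCount G r p q)) (*-recip (0<N pq)))

    0≤x : ∀ {p q} → Edge G p q → 0ℚ ≤ᵠ x p q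
    0≤x {p} {q} pq = subst (0ℚ ≤ᵠ_) (≡-sym (x-edge pq)) (0≤recip (pairCount G r p q))

    -- The bounds on `x` are the reciprocals of those on N: m = k!/n^k here and M = m/Λ in `x≤M`, so
    -- `ratio` reduces to `Λ-bound`.
    m≤x : ∀ p q → Edge G p q → F * P⁻¹ ≤ᵠ x p q
    m≤x p q pq = begin
      F * P⁻¹                    ≡⟨ ℚₚ.*-identityˡ (F * P⁻¹) ⟨
      1ℚ * (F * P⁻¹)             ≡⟨ cong (_* (F * P⁻¹)) (x-inv p q pq) ⟨
      x p q * N pq * (F * P⁻¹)   ≡⟨ solve 4 (λ x N F P → x :* N :* (F :* P) := x :* P :* (F :* N)) refl (x p q) (N pq) F P⁻¹ ⟩
      x p q * P⁻¹ * (F * N pq)   ≤⟨ *-monoʳ-≤ (0≤p*q (0≤x pq) (0≤recip P)) (upper pq) ⟩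
      x p q * P⁻¹ * P            ≡⟨ trans (ℚₚ.*-assoc (x p q) P⁻¹ P) (cong (x p q *_) (trans (ℚₚ.*-comm P⁻¹ P) (*-recip 0<P))) ⟩
      x p q * 1ℚ                 ≡⟨ ℚₚ.*-identityʳ (x p q) ⟩
      x p q                      ∎
      where open ℚₚ.≤-Reasoning

    x≤M : ∀ p q → Edge G p q → x p q ≤ᵠ F * P⁻¹ * Λ⁻¹
    x≤M p q pq = begin
      x p q                              ≡⟨ solve 1 (λ x → x := x :* (con 1ℚ :* con 1ℚ)) refl (x p q) ⟩
      x p q * (1ℚ * 1ℚ)                  ≡⟨ cong₂ (λ a b → x p q * (a * b)) (*-recip 0<P) (*-recip 0<Λ) ⟨
      x p q * (P * P⁻¹ * (Λ * Λ⁻¹))      ≡⟨ solve 5 (λ x P p L l → x :* (P :* p :* (L :* l)) := x :* p :* l :* (P :* L)) refl (x p q) P P⁻¹ Λ Λ⁻¹ ⟩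
      x p q * P⁻¹ * Λ⁻¹ * (P * Λ)        ≤⟨ *-monoʳ-≤ (0≤p*q (0≤p*q (0≤x pq) (0≤recip P)) (0≤recip Λ)) (lower pq) ⟩
      x p q * P⁻¹ * Λ⁻¹ * (F * N pq)     ≡⟨ solve 5 (λ x p l F N → x :* p :* l :* (F :* N) := x :* N :* (F :* p :* l)) refl (x p q) P⁻¹ Λ⁻¹ F (N pq) ⟩
      x p q * N pq * (F * P⁻¹ * Λ⁻¹)     ≡⟨ cong (_* (F * P⁻¹ * Λ⁻¹)) (x-inv p q pq) ⟩
      1ℚ * (F * P⁻¹ * Λ⁻¹)               ≡⟨ ℚₚ.*-identityˡ _ ⟩
      F * P⁻¹ * Λ⁻¹                      ∎
      where open ℚₚ.≤-Reasoning

    ratio : (κ * κ + κ) * (F * P⁻¹ * Λ⁻¹) ≤ᵠ (κ * κ + κ + 1ℚ) * (F * P⁻¹)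
    ratio = begin
      (κ * κ + κ) * (F * P⁻¹ * Λ⁻¹)
        ≡⟨ ℚₚ.*-comm (κ * κ + κ) (F * P⁻¹ * Λ⁻¹) ⟩
      F * P⁻¹ * Λ⁻¹ * (κ * κ + κ)
        ≤⟨ *-monoʳ-≤ (0≤p*q (0≤p*q (0≤fromℕ (k ℕ.!)) (0≤recip P)) (0≤recip Λ)) Λ-bound ⟩
      F * P⁻¹ * Λ⁻¹ * ((κ * κ + κ + 1ℚ) * Λ)
        ≡⟨ solve 5 (λ F p l a L → F :* p :* l :* (a :* L) := a :* (F :* p) :* (L :* l)) refl F P⁻¹ Λ⁻¹ (κ * κ + κ + 1ℚ) Λ ⟩
      (κ * κ + κ + 1ℚ) * (F * P⁻¹) * (Λ * Λ⁻¹)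
        ≡⟨ trans (cong ((κ * κ + κ + 1ℚ) * (F * P⁻¹) *_) (*-recip 0<Λ)) (ℚₚ.*-identityʳ _) ⟩
      (κ * κ + κ + 1ℚ) * (F * P⁻¹) ∎
      where open ℚₚ.≤-Reasoning

    0<2κ⟨κ-1⟩ : 0ℚ <ᵠ 2ℚ * (κ * (κ - 1ℚ))
    0<2κ⟨κ-1⟩ = 0<p*q (0<fromℕ 1) (0<p*q
      (ℚₚ.<-≤-trans (0<fromℕ 0) (fromℕ-mono 1≤k))
      (ℚₚ.<-≤-trans (0<fromℕ 0) (0≤q-p⇒p≤q (subst (0ℚ ≤ᵠ_)
        (solve 1 (λ k → k :- con 2ℚ := k :- con 1ℚ :- con 1ℚ) refl κ)
        (p≤q⇒0≤q-p (fromℕ-mono (ℕₚ.≤-trans (ℕ.s≤s (ℕ.s≤s ℕ.z≤n)) 3≤k)))))))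

  fractional-decomposition : FractionalDecomposition k G
  fractional-decomposition = Decomposition.decomposition G k 1≤k
    (0≤recip (2ℚ * (κ * (κ - 1ℚ)))) (*-recip 0<2κ⟨κ-1⟩) x x-sym x-irr x-inv m≤x x≤M ratio

theorem1p2 : (k : ℕ) → 3 ≤ k →
    Σ (ℕ → ℚ) λ f → IsLittleO f ×
    (∀ (n : ℕ) (G : Graph n) →
    MinDegreeAtLeast G (fromℕ n * (1ℚ - inv9k10 k) + f n) →
    FractionalDecomposition k G)
theorem1p2 k 3≤k = (λ _ → 0ℚ)
  , (λ ε 0<ε → 0 , λ m _ → 0≤p*q (ℚₚ.<⇒≤ 0<ε) (0≤fromℕ m))
  , decompose
  where
  decompose : ∀ n (G : Graph n) → MinDegreeAtLeast G (fromℕ n * (1ℚ - inv9k10 k) + 0ℚ) → FractionalDecomposition k G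
  -- The empty graph has no edge to cover. It is split off because `Dense` inverts n^k.
  decompose zero    G h = (λ _ → 0ℚ) , All.universal (λ _ → ℚₚ.≤-refl) (copies k G) , λ ()
  decompose (suc n) G h = Dense.fractional-decomposition k 3≤k G λ v →
    subst (_≤ᵠ fromℕ (degree G v)) (ℚₚ.+-identityʳ (fromℕ (suc n) * (1ℚ - inv9k10 k))) (h v)
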